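{- For every $\alpha\in(0,1)$, every randomized online algorithm for non-clairvoyant dynamic bin packing that makes at most $\alpha n$ migrations in expectation on every instance with $n$ items has competitive ratio at least $\frac14\left\lfloor \frac{1}{4\alpha}\right\rfloor$ with respect to the total active time objective.
   Context: Dynamic bin packing: bins have capacity $1$. Items $i=1,\dots,n$ arrive online at times $a_i\ge0$ with size $s_i\in[0,1]$ and duration $d_i>0$; item $i$ is present during $[a_i,a_i+d_i)$. Non-clairvoyant: at arrival only the size is revealed, not the duration. On arrival the item must be placed into an open bin with enough remaining capacity, or into a newly opened bin. A migration moves an already placed item to another bin; migrations are counted by number of moves. A bin is open while it contains an item. The cost (total active time) of an algorithm on instance $I$ is $\int_0^\infty (\text{number of open bins at time } t)\,dt$. $\mathrm{OPT}(I)=\int_0^\infty \mathrm{OPT}_t\,dt$, where $\mathrm{OPT}_t$ is the minimum number of unit bins needed to pack the items present at time $t$ (the optimal offline policy that knows the instance and may repack arbitrarily at any time). A randomized algorithm has competitive ratio at least $\gamma$ if for every $\beta<\gamma$ there is an instance $I$ with $\mathbb{E}[\mathrm{cost}(I)] > \beta\,\mathrm{OPT}(I)$. -}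

module Defs where

open import Algebra.Structures using (IsCommutativeRing)
open import Data.Bool.Base using (Bool; true; not; if_then_else_; T)
open import Data.Fin.Base as Fin using (Fin; toℕ)
open import Data.Integer.Base using (ℤ; +_; -[1+_])
open import Data.List.Base as List using (List; []; _∷_; _++_; map; filter; foldr; length; take; deduplicate)
open import Data.List.Relation.Unary.All using (All)
open import Data.List.Sort using (sort)
open import Data.Maybe.Base using (Maybe; just; nothing)
open import Data.Nat.Base as ℕ using (ℕ; zero; suc)
open import Data.Nat.Properties as ℕₚ using ()
open import Data.Product.Base using (_×_; _,_; ∃; ∃₂; proj₁; proj₂)
open import Data.Unit.Base using (⊤)
open import Data.Vec.Base as Vec using (Vec; _∷ʳ_; _[_]≔_; init; last; lookup; toList)
open import Function.Base using (_∘_; const)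
open import Function.Bundles using (_⇔_)
open import Relation.Binary.Bundles using (DecTotalOrder)
open import Relation.Binary.Construct.NonStrictToStrict as ToStrict using ()
open import Relation.Binary.PropositionalEquality using (_≡_; _≢_)
open import Relation.Binary.Structures using (IsDecTotalOrder)
open import Relation.Nullary using (Dec; ¬_; does)
open import Relation.Nullary.Decidable using (_×-dec_; ¬?)

-- The total inverse is unconstrained at 0.
record OrderedField : Set₁ where
  infix  4 _≤_ _<_ _<?_
  infixl 6 _+_ _-_
  infixl 7 _*_
  infix  8 -_
  infix  9 _⁻¹
  field
    ℝ   : Set
    _+_ : ℝ → ℝ → ℝ
    _*_ : ℝ → ℝ → ℝ
    -_  : ℝ → ℝ
    _⁻¹ : ℝ → ℝ
    0#  : ℝ
    1#  : ℝ
    _≤_ : ℝ → ℝ → Set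

    isCommutativeRing : IsCommutativeRing _≡_ _+_ _*_ -_ 0# 1#
    0≢1               : 0# ≢ 1#
    ⁻¹-inverse        : ∀ x → x ≢ 0# → x * x ⁻¹ ≡ 1#

    isDecTotalOrder   : IsDecTotalOrder _≡_ _≤_
    +-monoˡ-≤         : ∀ z {x y} → x ≤ y → x + z ≤ y + z
    *-nonNegative     : ∀ {x y} → 0# ≤ x → 0# ≤ y → 0# ≤ x * y

  ≤-decTotalOrder : DecTotalOrder _ _ _
  ≤-decTotalOrder = record { isDecTotalOrder = isDecTotalOrder }

  open IsDecTotalOrder isDecTotalOrder public using (_≤?_; _≟_)

  _<_ : ℝ → ℝ → Set
  _<_ = ToStrict._<_ _≡_ _≤_

  _<?_ : (x y : ℝ) → Dec (x < y)
  x <? y = (x ≤? y) ×-dec ¬? (x ≟ y)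

  _-_ : ℝ → ℝ → ℝ
  x - y = x + - y

  fromℕ : ℕ → ℝ
  fromℕ zero    = 0#
  fromℕ (suc n) = 1# + fromℕ n

  fromℤ : ℤ → ℝ
  fromℤ (+ n)    = fromℕ n
  fromℤ -[1+ n ] = - fromℕ (suc n)

  IsUpperBound : (ℝ → Set) → ℝ → Set
  IsUpperBound P u = ∀ x → P x → x ≤ u

  IsSupremum : (ℝ → Set) → ℝ → Set
  IsSupremum P s = IsUpperBound P s × (∀ u → IsUpperBound P u → s ≤ u)

-- The real numbers, given by their axioms: classically, ℝ is the unique ordered
-- field in which every non-empty set with an upper bound has a supremum.  The
-- floor function then exists classically as well; it is a field of the record only
-- because its derivation from the other axioms is not constructive.
record RealNumbers : Set₁ where
  field
    orderedField : OrderedField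

  open OrderedField orderedField public

  field
    complete    : (P : ℝ → Set) → ∃ P → ∃ (IsUpperBound P) → ∃ (IsSupremum P)
    ⌊_⌋         : ℝ → ℤ
    floor-lower : ∀ x → fromℤ ⌊ x ⌋ ≤ x
    floor-upper : ∀ x → x < fromℤ ⌊ x ⌋ + 1#

module Probability (reals : RealNumbers) where

  open RealNumbers reals

  sumℝ : List ℝ → ℝ
  sumℝ = foldr _+_ 0#

  -- Events are Bool-valued so that indicator functions exist constructively;
  -- classically they are all the subsets of the sample space.
  record ProbabilitySpace : Set₁ where
    field
      Ω : Set

    Event : Set
    Event = Ω → Bool

    IsUnion : (ℕ → Event) → Event → Set
    IsUnion A U = ∀ ω → T (U ω) ⇔ ∃ (λ n → T (A n ω))

    Disjoint : (ℕ → Event) → Set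
    Disjoint A = ∀ i j → i ≢ j → ∀ ω → ¬ (T (A i ω) × T (A j ω))

    field
      Measurable            : Event → Set
      measurable-full       : Measurable (const true)
      measurable-complement : ∀ {A} → Measurable A → Measurable (not ∘ A)
      measurable-union      : ∀ {A U} → (∀ n → Measurable (A n)) → IsUnion A U → Measurable U

      -- Only the values at measurable events are meaningful.
      ℙ             : Event → ℝ
      ℙ-nonNegative : ∀ {A} → Measurable A → 0# ≤ ℙ A
      ℙ-full        : ℙ (const true) ≡ 1#
      -- The terms are non-negative, so the sum of the series is the supremum of its
      -- partial sums.
      ℙ-additive    : ∀ {A U} → (∀ n → Measurable (A n)) → Disjoint A → IsUnion A U →
                      IsSupremum (λ x → ∃ λ n → x ≡ sumℝ (map (ℙ ∘ A) (List.upTo n))) (ℙ U)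

    IsRandomVariable : (Ω → ℝ) → Set
    IsRandomVariable X = ∀ c → Measurable (λ ω → does (X ω ≤? c))

    record SimpleFunction : Set where
      field
        terms       : List (ℝ × Event)
        nonNegative : All (λ term → 0# ≤ proj₁ term) terms
        measurable  : All (λ term → Measurable (proj₂ term)) terms

      value : Ω → ℝ
      value ω = sumℝ (map (λ term → if proj₂ term ω then proj₁ term else 0#) terms)

      integral : ℝ
      integral = sumℝ (map (λ term → proj₁ term * ℙ (proj₂ term)) terms)

    open SimpleFunction

    -- The expectation of a non-negative random variable X is the supremum, in
    -- [0,∞], of the integrals of the simple functions below X.  As it may be
    -- infinite, it enters through the comparisons 𝔼[ X ] ≤ c and 𝔼[ X ] > c.
    𝔼[_]≤_ : (Ω → ℝ) → ℝ → Set
    𝔼[ X ]≤ c = (φ : SimpleFunction) → (∀ ω → value φ ω ≤ X ω) → integral φ ≤ c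

    𝔼[_]>_ : (Ω → ℝ) → ℝ → Set
    𝔼[ X ]> c = ∃ λ (φ : SimpleFunction) → (∀ ω → value φ ω ≤ X ω) × c < integral φ

module BinPacking (reals : RealNumbers) where

  open RealNumbers reals
  open Probability reals public

  record Item : Set where
    field
      arrival    : ℝ
      size       : ℝ
      duration   : ℝ
      0≤arrival  : 0# ≤ arrival
      0≤size     : 0# ≤ size
      size≤1     : size ≤ 1#
      0<duration : 0# < duration

    departure : ℝ
    departure = arrival + duration

  open Item public

  Present : ℝ → Item → Set
  Present t x = arrival x ≤ t × t < departure x

  present? : ∀ t x → Dec (Present t x)
  present? t x = (arrival x ≤? t) ×-dec (t <? departure x)

  -- Items are numbered in order of arrival; simultaneous arrivals are revealed one
  -- after the other in this order.
  record Instance (n : ℕ) : Set where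
    field
      items  : Vec Item n
      sorted : ∀ i j → i Fin.≤ j → arrival (lookup items i) ≤ arrival (lookup items j)

  open Instance public

  -- A packing lists items together with the labels of their bins.
  Packing : Set
  Packing = List (Item × ℕ)

  load : ℕ → Packing → ℝ
  load b p = sumℝ (map (size ∘ proj₁) (filter (λ xc → proj₂ xc ℕₚ.≟ b) p))

  Feasible : Packing → Set
  Feasible p = ∀ b → load b p ≤ 1#

  openBins : Packing → ℕ
  openBins p = length (deduplicate ℕₚ._≟_ (map proj₂ p))

  -- ∫₀^∞ f(t) dt for a right-continuous step function f that jumps only at the given
  -- points and vanishes before the first and from the last of them on.
  stepIntegral : (ℝ → ℕ) → List ℝ → ℝ
  stepIntegral f points = go (sort ≤-decTotalOrder points)
    where
    go : List ℝ → ℝ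
    go []           = 0#
    go (p ∷ [])     = 0#
    go (p ∷ q ∷ ps) = (q - p) * fromℕ (f p) + go (q ∷ ps)

  IsMinBins : List Item → ℕ → Set
  IsMinBins xs b =
      (∃ λ p → map proj₁ p ≡ xs × Feasible p × openBins p ≡ b)
    × (∀ p → map proj₁ p ≡ xs → Feasible p → b ℕ.≤ openBins p)

  itemsAt : ∀ {n} → ℝ → Instance n → List Item
  itemsAt t I = filter (present? t) (toList (items I))

  IsOPT : ∀ {n} → Instance n → ℝ → Set
  IsOPT I v = ∃ λ (opt : ℝ → ℕ) →
      (∀ t → IsMinBins (itemsAt t I) (opt t))
    × v ≡ stepIntegral opt (map arrival xs ++ map departure xs)
    where xs = toList (items I)

  -- What an algorithm has done so far, the last action outermost, once the first k
  -- items are placed: "place l t b" puts the next item into bin b at time t, and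
  -- "move l t i b" migrates item i to bin b at time t.  A label whose bin is empty
  -- denotes a bin to be newly opened.
  data Log : ℕ → Set where
    start : Log 0
    place : ∀ {k} → Log k → ℝ → ℕ → Log (suc k)
    move  : ∀ {k} → Log k → ℝ → Fin k → ℕ → Log k

  bins : ∀ {k} → Log k → Vec ℕ k
  bins start          = Vec.[]
  bins (place l _ b)  = bins l ∷ʳ b
  bins (move l _ i b) = bins l [ i ]≔ b

  migrations : ∀ {k} → Log k → ℕ
  migrations start          = 0
  migrations (place l _ _)  = migrations l
  migrations (move l _ _ _) = suc (migrations l)

  times : ∀ {k} → Log k → List ℝ
  times start          = []
  times (place l t _)  = t ∷ times l
  times (move l t _ _) = t ∷ times l

  presentIn : ∀ {k} → ℝ → Vec Item k → Vec ℕ k → Packing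
  presentIn t xs bs = filter (present? t ∘ proj₁) (toList (Vec.zip xs bs))

  -- The packing in force at time t: all actions at times ≤ t have been carried out,
  -- and items with departure time ≤ t are gone.
  packingAt : ∀ {k} → ℝ → Vec Item k → Log k → Packing
  packingAt t xs start = []
  packingAt t xs l@(place l′ u _) =
    if does (u ≤? t) then presentIn t xs (bins l) else packingAt t (init xs) l′
  packingAt t xs l@(move l′ u _ _) =
    if does (u ≤? t) then presentIn t xs (bins l) else packingAt t xs l′

  NotBeforeEnd : ∀ {k} → ℝ → Log k → Set
  NotBeforeEnd t start          = ⊤
  NotBeforeEnd t (place _ u _)  = u ≤ t
  NotBeforeEnd t (move _ u _ _) = u ≤ t

  -- Every item is placed on arrival into a bin with enough remaining capacity, and
  -- only items that are present migrate, each to a bin other than its current one.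
  LegalActions : ∀ {k} → Vec Item k → Log k → Set
  LegalActions xs start = ⊤
  LegalActions xs (place l t b) =
      LegalActions (init xs) l
    × NotBeforeEnd t l
    × t ≡ arrival (last xs)
    × load b (presentIn t (init xs) (bins l)) + size (last xs) ≤ 1#
  LegalActions xs (move l t i b) =
      LegalActions xs l
    × NotBeforeEnd t l
    × t < departure (lookup xs i)
    × b ≢ lookup (bins l) i

  -- Migrations made at the same instant take effect together: apart from the check
  -- at placement, capacities are imposed on the packing in force at each time.
  Valid : ∀ {n} → Instance n → Log n → Set
  Valid I l = LegalActions (items I) l × (∀ t → Feasible (packingAt t (items I) l))

  activeTime : ∀ {n} → Instance n → Log n → ℝ
  activeTime I l =
    stepIntegral (λ t → openBins (packingAt t (items I) l))
                 (times l ++ map departure (toList (items I)))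

  -- What is known at time t about an item that has arrived: the departure time is
  -- known only if it is ≤ t.
  observe : ℝ → Item → ℝ × ℝ × Maybe ℝ
  observe t x =
    arrival x , size x , (if does (departure x ≤? t) then just (departure x) else nothing)

  history : ∀ {n} → ℝ → Instance n → List (ℝ × ℝ × Maybe ℝ)
  history t I = map (observe t) (filter (λ x → arrival x ≤? t) (toList (items I)))

  -- What is known when item i is placed: the items after i are not, even if they
  -- arrive at the same time.
  historyOnArrival : ∀ {n} (I : Instance n) → Fin n → List (ℝ × ℝ × Maybe ℝ)
  historyOnArrival I i =
    map (observe (arrival (lookup (items I) i))) (take (suc (toℕ i)) (toList (items I)))

  upToTime : ∀ {k} → ℝ → Log k → ∃ Log
  upToTime t start            = _ , start
  upToTime t l@(place l′ u _)  = if does (u ≤? t) then (_ , l) else upToTime t l′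
  upToTime t l@(move l′ u _ _) = if does (u ≤? t) then (_ , l) else upToTime t l′

  -- The part of the log that ends with the placement of item i (counted from 0).
  upToPlacement : ∀ {k} → ℕ → Log k → ∃ Log
  upToPlacement i start = _ , start
  upToPlacement i l@(place {k} l′ _ _) =
    if does (k ℕₚ.≟ i) then (_ , l) else upToPlacement i l′
  upToPlacement i (move l _ _ _) = upToPlacement i l

  -- An online non-clairvoyant algorithm acts at all times, not only at arrivals and
  -- departures, on the sole basis of what it has observed so far.
  record DeterministicAlgorithm : Set where
    field
      run   : ∀ {n} → Instance n → Log n
      valid : ∀ {n} (I : Instance n) → Valid I (run I)

      nonClairvoyant : ∀ {m n} (I : Instance m) (J : Instance n) t →
        history t I ≡ history t J →
        upToTime t (run I) ≡ upToTime t (run J)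

      nonClairvoyantOnArrival : ∀ {m n} (I : Instance m) (J : Instance n) i j →
        historyOnArrival I i ≡ historyOnArrival J j →
        upToPlacement (toℕ i) (run I) ≡ upToPlacement (toℕ j) (run J)

  record RandomizedAlgorithm : Set₁ where
    field
      space : ProbabilitySpace

    open ProbabilitySpace space public

    field
      algorithm : Ω → DeterministicAlgorithm

    runOn : ∀ {n} → Instance n → Ω → Log n
    runOn I ω = DeterministicAlgorithm.run (algorithm ω) I

    migrationCount : ∀ {n} → Instance n → Ω → ℝ
    migrationCount I ω = fromℕ (migrations (runOn I ω))

    cost : ∀ {n} → Instance n → Ω → ℝ
    cost I ω = activeTime I (runOn I ω)

    field
      migrationCount-isRandomVariable : ∀ {n} (I : Instance n) → IsRandomVariable (migrationCount I)
      cost-isRandomVariable           : ∀ {n} (I : Instance n) → IsRandomVariable (cost I)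

  MigratesAtMost : ℝ → RandomizedAlgorithm → Set
  MigratesAtMost α A = ∀ {n} (I : Instance n) → 𝔼[ migrationCount I ]≤ (α * fromℕ n)
    where open RandomizedAlgorithm A

  CompetitiveRatioAtLeast : ℝ → RandomizedAlgorithm → Set
  CompetitiveRatioAtLeast γ A =
    ∀ β → β < γ → ∃₂ λ n (I : Instance n) → ∃ λ opt → IsOPT I opt × 𝔼[ cost I ]> (β * opt)
    where open RandomizedAlgorithm A

{-# OPTIONS --safe #-}

-- With k = ⌊1/(4α)⌋, release k² items of size 1/k at time 0 and let k of them, drawn uniformly
-- with repetition, survive until time 1 + ε while all others leave at time ε.  One bin holds the
-- survivors, so OPT ≤ εk + 1.  The packing at time 0 cannot depend on the draw, and it puts at
-- most k items into a bin: the j-th draw hits a new bin with probability at least 1 − (j − 1)/k,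
-- so the survivors occupy at least k/2 bins in expectation.  A migration empties at most one of
-- these bins, and at most αk² ≤ k/4 migrations are expected, hence on average over the draws the
-- algorithm keeps k/4 bins open.  Some draw does as badly as the average.
--
-- The number of occupied bins need not be a random variable, only the cost and the number of
-- migrations are.  So the expectations are replaced by integrals of simple functions counting
-- the integers below the cost and below the number of migrations: their sum dominates the
-- number of initially occupied bins pointwise.

module Submission where

open import Algebra.Bundles using (CommutativeRing)
import Algebra.Properties.Ring as RingProperties
import Algebra.Solver.Ring.NaturalCoefficients.Default as SemiringSolver
open import Algebra.Structures using (IsCommutativeRing)
open import Data.Bool.Base using (true; false; if_then_else_; Bool; not; _∧_; _∨_; T)
open import Data.Bool.Properties using (∧-identityʳ)
open import Data.Empty using (⊥-elim)
open import Data.Fin.Base as Fin using (Fin)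
import Data.Fin.Properties as Finₚ
import Data.Integer.Base as ℤ
open import Data.List.Base as List using
  (List; []; _∷_; _++_; map; length; deduplicate; concatMap; filter; foldr; applyUpTo; upTo;
   downFrom; take; drop; allFin)
open import Data.List.Membership.Propositional using (_∈_)
open import Data.List.Membership.Propositional.Properties using
  (∈-deduplicate⁺; ∈-deduplicate⁻; ∈-upTo⁺; ∈-filter⁺; ∈-map⁺; ∈-map⁻; ∈-filter⁻; ∈-tabulate⁺;
   ∈-++⁺ˡ; ∈-++⁺ʳ; ∈-++⁻; ∈-allFin)
open import Data.List.Properties using
  (length-filter; length-map; map-++; filter-accept; filter-reject; filter-all; length-take;
   length-drop; take++drop≡id; map-∘; map-id; length-tabulate; length-upTo; map-cong; map-tabulate)
open import Data.List.Relation.Binary.Permutation.Propositional using (↭-sym)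
open import Data.List.Relation.Binary.Permutation.Propositional.Properties using (∈-resp-↭)
open import Data.List.Relation.Binary.Subset.Propositional using (_⊆_)
open import Data.List.Relation.Unary.All as All using (All; []; _∷_)
import Data.List.Relation.Unary.All.Properties as Allₚ
open import Data.List.Relation.Unary.AllPairs using ([]; _∷_; AllPairs)
open import Data.List.Relation.Unary.Any using (here; there; any?)
open import Data.List.Relation.Unary.Linked.Properties using (Linked⇒AllPairs)
open import Data.List.Relation.Unary.Unique.DecPropositional.Properties using (deduplicate-!)
open import Data.List.Relation.Unary.Unique.Propositional using (Unique)
import Data.List.Relation.Unary.Unique.Propositional.Properties as Uniqueₚ
open import Data.List.Sort using (sort; sort-↭; sort-↗)
open import Data.Maybe.Base using (nothing)
open import Data.Nat.Base as ℕ using (ℕ; zero; suc)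
import Data.Nat.DivMod as ℕ
open import Data.Nat.ListAction using (sum)
open import Data.Nat.ListAction.Properties using (sum-++)
import Data.Nat.Properties as ℕₚ
open import Data.Product.Base using (_×_; _,_; ∃; proj₁; proj₂; ∃₂; map₂)
open import Data.Sum.Base using (_⊎_; inj₁; inj₂)
open import Data.Unit.Base using (tt)
open import Data.Vec.Base as Vec using (Vec; []; _∷_; lookup; last; toList; _[_]≔_)
open import Data.Vec.Membership.Propositional.Properties using (∈-toList⁺; ∈-lookup)
open import Data.Vec.Properties using
  (lookup-zip; lookup∘update′; lookup∘tabulate; tabulate∘lookup; length-toList)
open import Defs
open import Function.Base using (_∘_; const; id)
open import Function.Bundles using (mk⇔)
open import Relation.Binary.Bundles using (DecTotalOrder)
open import Relation.Binary.Definitions using (DecidableEquality)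
open import Relation.Binary.PropositionalEquality using
  (_≡_; _≢_; refl; sym; trans; cong; cong₂; subst; subst₂; module ≡-Reasoning)
import Relation.Binary.Reasoning.PartialOrder
open import Relation.Nullary using (¬_; does; yes; no)
open import Relation.Nullary.Decidable using (dec-true; dec-false)
open import Relation.Unary using (Decidable)

-- The draws are summed before the expectation is taken. For a fixed outcome the packing at time 0
-- is one fixed map from items to bins, so the counting bound over all words of length `k` holds
-- outcome by outcome, and the sum over all words of the counting functions lies above a constant.
-- An integral therefore only has to be compared with a constant, which follows from finite
-- additivity. Drawing with repetition makes the average a recursion on the length of the word; a
-- repeated letter merely leaves fewer survivors, and they still fit into one bin. The survivors
-- outlive time 1 because measurability is given for the events "cost ≤ c". Their complements are
-- strict, and the additional ε makes h ≥ 1 bins, open for the time 1 + ε, cost strictly more than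
-- h. The value of ε comes last, from β, so that β(εk + 1) stays below k/4.

module Combinatorics where

  open import Data.Nat.Base
  open import Data.Nat.Properties
  open import Data.Nat.Solver using (module +-*-Solver)

  -- Finite sums of natural numbers over lists.

  sumBy : ∀ {A : Set} → (A → ℕ) → List A → ℕ
  sumBy f xs = sum (map f xs)

  module _ {A : Set} where

    sumBy-mono : ∀ {f g : A → ℕ} xs → (∀ {x} → x ∈ xs → f x ≤ g x) → sumBy f xs ≤ sumBy g xs
    sumBy-mono []       f≤g = z≤n
    sumBy-mono (x ∷ xs) f≤g = +-mono-≤ (f≤g (here refl)) (sumBy-mono xs (f≤g ∘ there))

    sumBy-const : ∀ c (xs : List A) → sumBy (λ _ → c) xs ≡ length xs * c
    sumBy-const c []       = refl
    sumBy-const c (x ∷ xs) = cong (c +_) (sumBy-const c xs)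

    sumBy-+ : ∀ (f g : A → ℕ) xs → sumBy (λ x → f x + g x) xs ≡ sumBy f xs + sumBy g xs
    sumBy-+ f g []       = refl
    sumBy-+ f g (x ∷ xs) = trans (cong (f x + g x +_) (sumBy-+ f g xs))
      (solve 4 (λ a b c d → (a :+ b) :+ (c :+ d) := (a :+ c) :+ (b :+ d)) refl
         (f x) (g x) (sumBy f xs) (sumBy g xs))
      where open +-*-Solver

    sumBy-* : ∀ c (f : A → ℕ) xs → sumBy (λ x → c * f x) xs ≡ c * sumBy f xs
    sumBy-* c f []       = sym (*-zeroʳ c)
    sumBy-* c f (x ∷ xs) =
      trans (cong (c * f x +_) (sumBy-* c f xs)) (sym (*-distribˡ-+ c (f x) (sumBy f xs)))

    sumBy-++ : ∀ (f : A → ℕ) xs ys → sumBy f (xs ++ ys) ≡ sumBy f xs + sumBy f ys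
    sumBy-++ f xs ys = trans (cong sum (map-++ f xs ys)) (sum-++ (map f xs) (map f ys))

  module _ {A B : Set} where

    sumBy-map : ∀ (f : B → ℕ) (g : A → B) xs → sumBy f (map g xs) ≡ sumBy (f ∘ g) xs
    sumBy-map f g []       = refl
    sumBy-map f g (x ∷ xs) = cong (f (g x) +_) (sumBy-map f g xs)

    sumBy-concatMap : ∀ (f : B → ℕ) (g : A → List B) xs →
                      sumBy f (concatMap g xs) ≡ sumBy (λ x → sumBy f (g x)) xs
    sumBy-concatMap f g []       = refl
    sumBy-concatMap f g (x ∷ xs) =
      trans (sumBy-++ f (g x) (concatMap g xs)) (cong (sumBy f (g x) +_) (sumBy-concatMap f g xs))

    sumBy-swap : ∀ (f : A → B → ℕ) xs ys →
                 sumBy (λ x → sumBy (f x) ys) xs ≡ sumBy (λ y → sumBy (λ x → f x y) xs) ys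
    sumBy-swap f []       ys = sym (trans (sumBy-const 0 ys) (*-zeroʳ (length ys)))
    sumBy-swap f (x ∷ xs) ys =
      trans (cong (sumBy (f x) ys +_) (sumBy-swap f xs ys))
            (sym (sumBy-+ (f x) (λ y → sumBy (λ x → f x y) xs) ys))

  -- Multiplicities and numbers of distinct elements.

  module Cardinality {A : Set} (_≟_ : DecidableEquality A) where

    δ : A → A → ℕ
    δ x y = if does (x ≟ y) then 1 else 0

    δ-refl : ∀ x → δ x x ≡ 1
    δ-refl x rewrite dec-true (x ≟ x) refl = refl

    δ-≢ : ∀ {x y} → x ≢ y → δ x y ≡ 0
    δ-≢ {x} {y} x≢y rewrite dec-false (x ≟ y) x≢y = refl

    δ-sym : ∀ x y → δ x y ≡ δ y x
    δ-sym x y with x ≟ y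
    ... | yes refl = sym (δ-refl x)
    ... | no  x≢y  = sym (δ-≢ (x≢y ∘ sym))

    count : A → List A → ℕ
    count x = sumBy (δ x)

    count-∈ : ∀ {x xs} → x ∈ xs → 1 ≤ count x xs
    count-∈ {x} {_ ∷ xs} (here refl)  rewrite δ-refl x = s≤s z≤n
    count-∈ {x} {y ∷ xs} (there x∈xs) = ≤-trans (count-∈ x∈xs) (m≤n+m _ (δ x y))

    count-∉ : ∀ {x} xs → All (x ≢_) xs → count x xs ≡ 0
    count-∉ []       []           = refl
    count-∉ (y ∷ xs) (x≢y ∷ x∉xs) = cong₂ _+_ (δ-≢ x≢y) (count-∉ xs x∉xs)

    count-unique : ∀ x {xs} → Unique xs → count x xs ≤ 1
    count-unique x []                     = z≤n
    count-unique x (_∷_ {y} {xs} y∉xs u) with x ≟ y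
    ... | yes refl = ≤-reflexive (cong suc (count-∉ xs y∉xs))
    ... | no  _    = count-unique x u

    -- Double counting of the pairs of equal elements of ys and bs.
    length-≤-count : ∀ k {ys bs} → (∀ b → count b ys ≤ k) → ys ⊆ bs → length ys ≤ length bs * k
    length-≤-count k {ys} {bs} few ys⊆bs = begin
      length ys                                  ≡⟨ *-identityʳ (length ys) ⟨
      length ys * 1                              ≡⟨ sumBy-const 1 ys ⟨
      sumBy (λ _ → 1) ys                         ≤⟨ sumBy-mono ys (count-∈ ∘ ys⊆bs) ⟩
      sumBy (λ y → sumBy (δ y) bs) ys            ≡⟨ sumBy-swap δ ys bs ⟩
      sumBy (λ b → sumBy (λ y → δ y b) ys) bs    ≤⟨ sumBy-mono bs (λ {b} _ →
                                                      sumBy-mono ys (λ {y} _ → ≤-reflexive (δ-sym y b))) ⟩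
      sumBy (λ b → count b ys) bs                ≤⟨ sumBy-mono bs (λ {b} _ → few b) ⟩
      sumBy (λ _ → k) bs                         ≡⟨ sumBy-const k bs ⟩
      length bs * k                              ∎
      where open ≤-Reasoning

    length-unique-⊆ : ∀ {xs ys} → Unique xs → xs ⊆ ys → length xs ≤ length ys
    length-unique-⊆ {xs} {ys} u xs⊆ys =
      ≤-trans (length-≤-count 1 (λ b → count-unique b u) xs⊆ys) (≤-reflexive (*-identityʳ (length ys)))

    card : List A → ℕ
    card xs = length (deduplicate _≟_ xs)

    card-≤ : ∀ {xs ys} → xs ⊆ ys → card xs ≤ length ys
    card-≤ {xs} xs⊆ys =
      length-unique-⊆ (deduplicate-! _≟_ xs) (xs⊆ys ∘ ∈-deduplicate⁻ _≟_ xs)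

    card-mono : ∀ {xs ys} → xs ⊆ ys → card xs ≤ card ys
    card-mono xs⊆ys = card-≤ (∈-deduplicate⁺ _≟_ ∘ xs⊆ys)

    card-∷-≤ : ∀ x xs → card (x ∷ xs) ≤ suc (card xs)
    card-∷-≤ x xs = s≤s (length-filter _ (deduplicate _≟_ xs))

    -- If `x` occurs already, its multiplicity pays for the missing increment. Summed over all
    -- choices of `x` this is a union bound: the event that `x` is new gives way to a number of
    -- coincidences, which is additive over `xs`.
    card-∷-≥ : ∀ x xs → suc (card xs) ≤ card (x ∷ xs) + count x xs
    card-∷-≥ x xs with any? (x ≟_) xs
    ... | yes x∈xs = begin
      suc (card xs)                 ≡⟨ +-comm 1 (card xs) ⟩
      card xs + 1                   ≤⟨ +-mono-≤ (card-mono {xs} {x ∷ xs} there) (count-∈ x∈xs) ⟩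
      card (x ∷ xs) + count x xs    ∎
      where open ≤-Reasoning
    ... | no  x∉xs = ≤-trans (length-unique-⊆ unique incl) (m≤m+n _ _)
      where
      unique : Unique (x ∷ deduplicate _≟_ xs)
      unique = All.tabulate (λ {y} y∈ x≡y → x∉xs (subst (_∈ xs) (sym x≡y) (∈-deduplicate⁻ _≟_ xs y∈)))
               ∷ deduplicate-! _≟_ xs
      incl : (x ∷ deduplicate _≟_ xs) ⊆ deduplicate _≟_ (x ∷ xs)
      incl (here refl) = here refl
      incl (there y∈)  = ∈-deduplicate⁺ _≟_ {x ∷ xs} (there (∈-deduplicate⁻ _≟_ xs y∈))

  -- Random words and the expected number of bins they hit.

  -- A sum over this list is `length xs ^ j` times the expectation over `j` independent uniform
  -- draws; working with sums keeps all estimates in the natural numbers.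
  words : ∀ {A : Set} → List A → ∀ j → List (Vec A j)
  words xs zero    = [] ∷ []
  words xs (suc j) = concatMap (λ w → map (_∷ w) xs) (words xs j)

  sumBy-words : ∀ {A : Set} (xs : List A) j (f : Vec A (suc j) → ℕ) →
                sumBy f (words xs (suc j)) ≡ sumBy (λ w → sumBy (λ x → f (x ∷ w)) xs) (words xs j)
  sumBy-words xs j f = trans (sumBy-concatMap f _ (words xs j))
    (cong sum (map-cong (λ w → sumBy-map f (_∷ w) xs) (words xs j)))

  length-words : ∀ {A : Set} (xs : List A) j → length (words xs j) ≡ length xs ^ j
  length-words xs zero    = refl
  length-words xs (suc j) = begin
    length (words xs (suc j))                              ≡⟨ *-identityʳ _ ⟨
    length (words xs (suc j)) * 1                          ≡⟨ sumBy-const 1 (words xs (suc j)) ⟨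
    sumBy (λ _ → 1) (words xs (suc j))                     ≡⟨ sumBy-words xs j (λ _ → 1) ⟩
    sumBy (λ _ → sumBy (λ _ → 1) xs) (words xs j)          ≡⟨ sumBy-const _ (words xs j) ⟩
    length (words xs j) * sumBy (λ _ → 1) xs               ≡⟨ cong₂ _*_ (length-words xs j)
                                                                   (trans (sumBy-const 1 xs) (*-identityʳ _)) ⟩
    length xs ^ j * length xs                              ≡⟨ *-comm (length xs ^ j) (length xs) ⟩
    length xs * length xs ^ j                              ∎
    where open ≡-Reasoning

  words-nonempty : ∀ {A : Set} {x : A} {xs} → x ∈ xs → ∀ j → 0 < length (words xs j)
  words-nonempty {xs = xs@(_ ∷ _)} _ j = subst (0 <_) (sym (length-words xs j)) (m^n>0 (length xs) j)

  hits : ∀ {A : Set} → (A → ℕ) → List A → ℕ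
  hits bin xs = Cardinality.card _≟_ (map bin xs)

  module _ {A : Set} (xs : List A) (bin : A → ℕ) where

    open Cardinality _≟_

    private
      n : ℕ
      n = length xs

    -- The expected number of bins hit by `j` draws, multiplied by `n ^ j`.
    totalHits : ℕ → ℕ
    totalHits j = sumBy (hits bin ∘ Vec.toList) (words xs j)

    module _ (k : ℕ) (few : ∀ b → count b (map bin xs) ≤ k) where

      -- Exchanging the sums counts coincidences from the side of the `j` bins already drawn: each
      -- of them contains at most `k` of the items, so at most `j * k` pairs of a new item and an
      -- old letter collide.
      hits-∷ : ∀ {j} (w : Vec A j) →
        n * hits bin (Vec.toList w) + n ≤ sumBy (λ x → hits bin (x ∷ Vec.toList w)) xs + j * k
      hits-∷ {j} w = begin
        n * hits bin (Vec.toList w) + n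
          ≡⟨ solve 2 (λ n h → n :* h :+ n := n :* (con 1 :+ h)) refl n (hits bin (Vec.toList w)) ⟩
        n * suc (hits bin (Vec.toList w))
          ≡⟨ sumBy-const _ xs ⟨
        sumBy (λ _ → suc (hits bin (Vec.toList w))) xs
          ≤⟨ sumBy-mono xs (λ {x} _ → card-∷-≥ (bin x) ys) ⟩
        sumBy (λ x → hits bin (x ∷ Vec.toList w) + count (bin x) ys) xs
          ≡⟨ sumBy-+ (λ x → hits bin (x ∷ Vec.toList w)) (λ x → count (bin x) ys) xs ⟩
        sumBy (λ x → hits bin (x ∷ Vec.toList w)) xs + sumBy (λ x → count (bin x) ys) xs
          ≡⟨ cong (sumBy (λ x → hits bin (x ∷ Vec.toList w)) xs +_) (sumBy-swap (λ x y → δ (bin x) y) xs ys) ⟩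
        sumBy (λ x → hits bin (x ∷ Vec.toList w)) xs + sumBy (λ y → sumBy (λ x → δ (bin x) y) xs) ys
          ≤⟨ +-monoʳ-≤ _ (sumBy-mono ys (λ {y} _ → bound y)) ⟩
        sumBy (λ x → hits bin (x ∷ Vec.toList w)) xs + sumBy (λ _ → k) ys
          ≡⟨ cong (sumBy (λ x → hits bin (x ∷ Vec.toList w)) xs +_) (trans (sumBy-const k ys) (cong (_* k) len)) ⟩
        sumBy (λ x → hits bin (x ∷ Vec.toList w)) xs + j * k
          ∎
        where
        open ≤-Reasoning
        open +-*-Solver
        ys = map bin (Vec.toList w)
        len : length ys ≡ j
        len = trans (length-map bin (Vec.toList w)) (length-toList w)
        bound : ∀ y → sumBy (λ x → δ (bin x) y) xs ≤ k
        bound y = begin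
          sumBy (λ x → δ (bin x) y) xs   ≤⟨ sumBy-mono xs (λ {x} _ → ≤-reflexive (δ-sym (bin x) y)) ⟩
          sumBy (λ x → δ y (bin x)) xs   ≡⟨ sumBy-map (δ y) bin xs ⟨
          count y (map bin xs)           ≤⟨ few y ⟩
          k                              ∎

      totalHits-suc : ∀ j → n * totalHits j + n ^ j * n ≤ totalHits (suc j) + n ^ j * (j * k)
      totalHits-suc j = begin
        n * totalHits j + n ^ j * n
          ≡⟨ cong₂ _+_ (sumBy-* n (hits bin ∘ Vec.toList) ws)
                       (trans (sumBy-const n ws) (cong (_* n) (length-words xs j))) ⟨
        sumBy (λ w → n * hits bin (Vec.toList w)) ws + sumBy (λ _ → n) ws
          ≡⟨ sumBy-+ _ _ ws ⟨
        sumBy (λ w → n * hits bin (Vec.toList w) + n) ws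
          ≤⟨ sumBy-mono ws (λ {w} _ → hits-∷ w) ⟩
        sumBy (λ w → sumBy (λ x → hits bin (x ∷ Vec.toList w)) xs + j * k) ws
          ≡⟨ sumBy-+ _ _ ws ⟩
        sumBy (λ w → sumBy (λ x → hits bin (x ∷ Vec.toList w)) xs) ws + sumBy (λ _ → j * k) ws
          ≡⟨ cong₂ _+_ (sym (sumBy-words xs j (hits bin ∘ Vec.toList)))
                       (trans (sumBy-const (j * k) ws) (cong (_* (j * k)) (length-words xs j))) ⟩
        totalHits (suc j) + n ^ j * (j * k)
          ∎
        where
        open ≤-Reasoning
        ws = words xs j

      -- The (j+1)-st random item lands in a new bin with probability at least 1 − j/k, so the
      -- expected number of bins hit by j of them is at least j − j²/2k.
      totalHits-≥ : n ≡ k * k → ∀ j → 2 * k * j * n ^ j ≤ 2 * k * totalHits j + n ^ j * (j * j)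
      totalHits-≥ n≡k² zero    = ≤-trans (≤-reflexive (cong (_* 1) (*-zeroʳ (2 * k)))) z≤n
      totalHits-≥ n≡k² (suc j) = +-cancelʳ-≤ (2 * k * (N * (j * k))) _ _ (begin
        2 * k * suc j * (n * N) + 2 * k * (N * (j * k))
          ≡⟨ cong (λ m → 2 * k * suc j * (m * N) + 2 * k * (N * (j * k))) n≡k² ⟩
        2 * k * suc j * (k * k * N) + 2 * k * (N * (j * k))
          ≡⟨ solve 3 (λ k j N → con 2 :* k :* (con 1 :+ j) :* (k :* k :* N) :+ con 2 :* k :* (N :* (j :* k))
                             := k :* k :* (con 2 :* k :* j :* N)
                                :+ (con 2 :* k :* (N :* (k :* k)) :+ con 2 :* k :* (N :* (j :* k))))
               refl k j N ⟩
        k * k * (2 * k * j * N) + (2 * k * (N * (k * k)) + 2 * k * (N * (j * k)))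
          ≤⟨ +-monoˡ-≤ _ (*-monoʳ-≤ (k * k) (totalHits-≥ n≡k² j)) ⟩
        k * k * (2 * k * totalHits j + N * (j * j)) + (2 * k * (N * (k * k)) + 2 * k * (N * (j * k)))
          ≡⟨ solve 4 (λ k j N t → k :* k :* (con 2 :* k :* t :+ N :* (j :* j))
                                  :+ (con 2 :* k :* (N :* (k :* k)) :+ con 2 :* k :* (N :* (j :* k)))
                               := con 2 :* k :* (k :* k :* t :+ N :* (k :* k))
                                  :+ k :* k :* N :* (j :* j :+ con 2 :* j))
               refl k j N (totalHits j) ⟩
        2 * k * (k * k * totalHits j + N * (k * k)) + k * k * N * (j * j + 2 * j)
          ≡⟨ cong (λ m → 2 * k * (m * totalHits j + N * m) + m * N * (j * j + 2 * j)) n≡k² ⟨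
        2 * k * (n * totalHits j + N * n) + n * N * (j * j + 2 * j)
          ≤⟨ +-mono-≤ (*-monoʳ-≤ (2 * k) (totalHits-suc j))
                      (*-monoʳ-≤ (n * N) (≤-trans (n≤1+n _) (≤-reflexive square))) ⟩
        2 * k * (totalHits (suc j) + N * (j * k)) + n * N * (suc j * suc j)
          ≡⟨ solve 4 (λ k a b c → con 2 :* k :* (a :+ b) :+ c := con 2 :* k :* a :+ c :+ con 2 :* k :* b)
               refl k (totalHits (suc j)) (N * (j * k)) (n * N * (suc j * suc j)) ⟩
        2 * k * totalHits (suc j) + n * N * (suc j * suc j) + 2 * k * (N * (j * k))
          ∎)
        where
        open ≤-Reasoning
        open +-*-Solver
        N = n ^ j
        -- The losses i/k for i < j add up to j(j - 1)/2k; raising j² + 2j to (j + 1)² gives away a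
        -- little and keeps the bound a pure square.
        square : suc (j * j + 2 * j) ≡ suc j * suc j
        square = solve 1 (λ j → con 1 :+ (j :* j :+ con 2 :* j) := (con 1 :+ j) :* (con 1 :+ j)) refl j

      -- At `j = k` the bound j - j²/2k becomes k/2.
      average-hits : .{{_ : NonZero k}} → n ≡ k * k → k * length (words xs k) ≤ 2 * totalHits k
      average-hits n≡k² rewrite length-words xs k = *-cancelˡ-≤ k (+-cancelʳ-≤ (N * (k * k)) _ _ (begin
        k * (k * N) + N * (k * k)
          ≡⟨ solve 2 (λ k N → k :* (k :* N) :+ N :* (k :* k) := con 2 :* k :* k :* N) refl k N ⟩
        2 * k * k * N
          ≤⟨ totalHits-≥ n≡k² k ⟩
        2 * k * totalHits k + N * (k * k)
          ≡⟨ cong (_+ N * (k * k)) (solve 2 (λ k t → con 2 :* k :* t := k :* (con 2 :* t)) refl k (totalHits k)) ⟩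
        k * (2 * totalHits k) + N * (k * k)
          ∎))
        where
        open ≤-Reasoning
        open +-*-Solver
        N = n ^ k

open Combinatorics

-- Arithmetic of ordered fields.

module OrderedFieldProperties (F : OrderedField) where

  open OrderedField F
  open IsCommutativeRing isCommutativeRing public
    using (+-comm; +-assoc; *-comm; *-assoc; +-identityˡ; +-identityʳ; *-identityˡ; *-identityʳ;
           zeroˡ; zeroʳ; distribˡ; distribʳ; -‿inverseˡ; -‿inverseʳ)
  open DecTotalOrder ≤-decTotalOrder public
    using (poset) renaming
    (total to ≤-total; refl to ≤-refl; reflexive to ≤-reflexive; trans to ≤-trans; antisym to ≤-antisym)
  module ≤-Reasoning = Relation.Binary.Reasoning.PartialOrder poset
  open ≤-Reasoning

  private
    commutativeRing : CommutativeRing _ _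
    commutativeRing = record { isCommutativeRing = isCommutativeRing }
  open RingProperties (CommutativeRing.ring commutativeRing) using (-1*x≈-x; -‿involutive)

  module Solver = SemiringSolver (CommutativeRing.commutativeSemiring commutativeRing)
  open Solver using (solve; _:=_; _:+_; _:*_; con)

  <⇒≤ : ∀ {x y} → x < y → x ≤ y
  <⇒≤ = proj₁

  ≰⇒> : ∀ {x y} → ¬ x ≤ y → y < x
  ≰⇒> {x} {y} x≰y with ≤-total x y
  ... | inj₁ x≤y = ⊥-elim (x≰y x≤y)
  ... | inj₂ y≤x = y≤x , λ y≡x → x≰y (≤-reflexive (sym y≡x))

  <⇒≱ : ∀ {x y} → x < y → ¬ y ≤ x
  <⇒≱ (x≤y , x≢y) y≤x = x≢y (≤-antisym x≤y y≤x)

  ≤-<-connex : ∀ x y → x ≤ y ⊎ y < x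
  ≤-<-connex x y with x ≤? y
  ... | yes x≤y = inj₁ x≤y
  ... | no  x≰y = inj₂ (≰⇒> x≰y)

  <-≤-trans : ∀ {x y z} → x < y → y ≤ z → x < z
  <-≤-trans x<y y≤z = begin-strict _ <⟨ x<y ⟩ _ ≤⟨ y≤z ⟩ _ ∎

  ≤-<-trans : ∀ {x y z} → x ≤ y → y < z → x < z
  ≤-<-trans x≤y y<z = begin-strict _ ≤⟨ x≤y ⟩ _ <⟨ y<z ⟩ _ ∎

  -‿+-cancel : ∀ x y → x - y + y ≡ x
  -‿+-cancel x y = trans (+-assoc x (- y) y) (trans (cong (x +_) (-‿inverseˡ y)) (+-identityʳ x))

  +-‿-cancel : ∀ x y → x + y - y ≡ x
  +-‿-cancel x y = trans (+-assoc x y (- y)) (trans (cong (x +_) (-‿inverseʳ y)) (+-identityʳ x))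

  x-0≡x : ∀ x → x - 0# ≡ x
  x-0≡x x = trans (sym (+-identityʳ (x - 0#))) (-‿+-cancel x 0#)

  +-monoʳ-≤ : ∀ z {x y} → x ≤ y → z + x ≤ z + y
  +-monoʳ-≤ z {x} {y} x≤y = subst₂ _≤_ (+-comm x z) (+-comm y z) (+-monoˡ-≤ z x≤y)

  +-mono-≤ : ∀ {x y u v} → x ≤ y → u ≤ v → x + u ≤ y + v
  +-mono-≤ {y = y} {u} x≤y u≤v = ≤-trans (+-monoˡ-≤ u x≤y) (+-monoʳ-≤ y u≤v)

  +-cancelʳ-≤ : ∀ z {x y} → x + z ≤ y + z → x ≤ y
  +-cancelʳ-≤ z {x} {y} le = subst₂ _≤_ (+-‿-cancel x z) (+-‿-cancel y z) (+-monoˡ-≤ (- z) le)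

  +-cancelʳ-≡ : ∀ z {x y} → x + z ≡ y + z → x ≡ y
  +-cancelʳ-≡ z {x} {y} eq = trans (sym (+-‿-cancel x z)) (trans (cong (_- z) eq) (+-‿-cancel y z))

  +-monoˡ-< : ∀ z {x y} → x < y → x + z < y + z
  +-monoˡ-< z (x≤y , x≢y) = +-monoˡ-≤ z x≤y , x≢y ∘ +-cancelʳ-≡ z

  +-monoʳ-< : ∀ z {x y} → x < y → z + x < z + y
  +-monoʳ-< z {x} {y} x<y = subst₂ _<_ (+-comm x z) (+-comm y z) (+-monoˡ-< z x<y)

  x≤x+y : ∀ {x y} → 0# ≤ y → x ≤ x + y
  x≤x+y {x} {y} 0≤y = subst (_≤ x + y) (+-identityʳ x) (+-monoʳ-≤ x 0≤y)

  x<x+y : ∀ {x y} → 0# < y → x < x + y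
  x<x+y {x} {y} 0<y = subst (_< x + y) (+-identityʳ x) (+-monoʳ-< x 0<y)

  x≤y⇒0≤y-x : ∀ {x y} → x ≤ y → 0# ≤ y - x
  x≤y⇒0≤y-x {x} {y} x≤y = subst (_≤ y - x) (-‿inverseʳ x) (+-monoˡ-≤ (- x) x≤y)

  x<y⇒0<y-x : ∀ {x y} → x < y → 0# < y - x
  x<y⇒0<y-x {x} {y} x<y = subst (_< y - x) (-‿inverseʳ x) (+-monoˡ-< (- x) x<y)

  -‿antitone : ∀ {x y} → x ≤ y → - y ≤ - x
  -‿antitone {x} {y} x≤y = +-cancelʳ-≤ y (begin
    - y + y    ≡⟨ -‿inverseˡ y ⟩
    0#         ≤⟨ x≤y⇒0≤y-x x≤y ⟩
    y - x      ≡⟨ +-comm y (- x) ⟩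
    - x + y    ∎)

  *-monoˡ-≤ : ∀ {c x y} → 0# ≤ c → x ≤ y → c * x ≤ c * y
  *-monoˡ-≤ {c} {x} {y} 0≤c x≤y = begin
    c * x                  ≡⟨ +-identityˡ (c * x) ⟨
    0# + c * x             ≤⟨ +-monoˡ-≤ (c * x) (*-nonNegative 0≤c (x≤y⇒0≤y-x x≤y)) ⟩
    c * (y - x) + c * x    ≡⟨ distribˡ c (y - x) x ⟨
    c * (y - x + x)        ≡⟨ cong (c *_) (-‿+-cancel y x) ⟩
    c * y                  ∎

  *-monoʳ-≤ : ∀ {c x y} → 0# ≤ c → x ≤ y → x * c ≤ y * c
  *-monoʳ-≤ {c} {x} {y} 0≤c x≤y = subst₂ _≤_ (*-comm c x) (*-comm c y) (*-monoˡ-≤ 0≤c x≤y)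

  0≤1 : 0# ≤ 1#
  0≤1 with ≤-total 0# 1#
  ... | inj₁ 0≤1 = 0≤1
  ... | inj₂ 1≤0 = begin
    0#             ≤⟨ *-nonNegative 0≤-1 0≤-1 ⟩
    - 1# * - 1#    ≡⟨ -1*x≈-x (- 1#) ⟩
    - - 1#         ≡⟨ -‿involutive 1# ⟩
    1#             ∎
    where
    0≤-1 : 0# ≤ - 1#
    0≤-1 = subst (0# ≤_) (+-identityˡ (- 1#)) (x≤y⇒0≤y-x 1≤0)

  0<1 : 0# < 1#
  0<1 = 0≤1 , 0≢1

  >⇒≢0 : ∀ {c} → 0# < c → c ≢ 0#
  >⇒≢0 (_ , 0≢c) c≡0 = 0≢c (sym c≡0)

  ⁻¹-*-cancel : ∀ {c} → 0# < c → ∀ x → c ⁻¹ * (c * x) ≡ x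
  ⁻¹-*-cancel {c} 0<c x = begin-equality
    c ⁻¹ * (c * x)    ≡⟨ solve 3 (λ c d x → d :* (c :* x) := c :* d :* x) refl c (c ⁻¹) x ⟩
    c * c ⁻¹ * x      ≡⟨ cong (_* x) (⁻¹-inverse c (>⇒≢0 0<c)) ⟩
    1# * x            ≡⟨ *-identityˡ x ⟩
    x                 ∎

  *-⁻¹-cancel : ∀ {c} → 0# < c → ∀ x → c * (c ⁻¹ * x) ≡ x
  *-⁻¹-cancel {c} 0<c x = begin-equality
    c * (c ⁻¹ * x)    ≡⟨ *-assoc c (c ⁻¹) x ⟨
    c * c ⁻¹ * x      ≡⟨ cong (_* x) (⁻¹-inverse c (>⇒≢0 0<c)) ⟩
    1# * x            ≡⟨ *-identityˡ x ⟩
    x                 ∎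

  *-monoˡ-< : ∀ {c x y} → 0# < c → x < y → c * x < c * y
  *-monoˡ-< {c} {x} {y} 0<c (x≤y , x≢y) = *-monoˡ-≤ (<⇒≤ 0<c) x≤y ,
    λ eq → x≢y (trans (sym (⁻¹-*-cancel 0<c x)) (trans (cong (c ⁻¹ *_) eq) (⁻¹-*-cancel 0<c y)))

  *-cancelˡ-≤ : ∀ {c x y} → 0# < c → c * x ≤ c * y → x ≤ y
  *-cancelˡ-≤ {c} {x} {y} 0<c cx≤cy with x ≤? y
  ... | yes x≤y = x≤y
  ... | no  x≰y = ⊥-elim (<⇒≱ (*-monoˡ-< 0<c (≰⇒> x≰y)) cx≤cy)

  *-positive : ∀ {x y} → 0# < x → 0# < y → 0# < x * y
  *-positive {x} {y} 0<x 0<y = subst (_< x * y) (zeroʳ x) (*-monoˡ-< 0<x 0<y)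

  ⁻¹-positive : ∀ {x} → 0# < x → 0# < x ⁻¹
  ⁻¹-positive {x} 0<x = ≰⇒> λ x⁻¹≤0 → <⇒≱ 0<1 (begin
    1#          ≡⟨ ⁻¹-inverse x (>⇒≢0 0<x) ⟨
    x * x ⁻¹    ≤⟨ *-monoˡ-≤ (<⇒≤ 0<x) x⁻¹≤0 ⟩
    x * 0#      ≡⟨ zeroʳ x ⟩
    0#          ∎)

  0≤fromℕ : ∀ n → 0# ≤ fromℕ n
  0≤fromℕ zero    = ≤-refl
  0≤fromℕ (suc n) = ≤-trans 0≤1 (x≤x+y (0≤fromℕ n))

  0<fromℕ-suc : ∀ n → 0# < fromℕ (suc n)
  0<fromℕ-suc n = <-≤-trans 0<1 (x≤x+y (0≤fromℕ n))

  fromℕ-mono-≤ : ∀ {m n} → m ℕ.≤ n → fromℕ m ≤ fromℕ n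
  fromℕ-mono-≤ {n = n} ℕ.z≤n = 0≤fromℕ n
  fromℕ-mono-≤ (ℕ.s≤s m≤n)   = +-monoʳ-≤ 1# (fromℕ-mono-≤ m≤n)

  fromℕ-mono-< : ∀ {m n} → m ℕ.< n → fromℕ m < fromℕ n
  fromℕ-mono-< {m} m<n =
    <-≤-trans (subst (fromℕ m <_) (+-comm (fromℕ m) 1#) (x<x+y 0<1)) (fromℕ-mono-≤ m<n)

  fromℕ-cancel-≤ : ∀ {m n} → fromℕ m ≤ fromℕ n → m ℕ.≤ n
  fromℕ-cancel-≤ le = ℕₚ.≮⇒≥ λ n<m → <⇒≱ (fromℕ-mono-< n<m) le

  fromℕ-cancel-< : ∀ {m n} → fromℕ m < fromℕ n → m ℕ.< n
  fromℕ-cancel-< lt = ℕₚ.≰⇒> λ n≤m → <⇒≱ lt (fromℕ-mono-≤ n≤m)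

  fromℕ-+ : ∀ m n → fromℕ (m ℕ.+ n) ≡ fromℕ m + fromℕ n
  fromℕ-+ zero    n = sym (+-identityˡ (fromℕ n))
  fromℕ-+ (suc m) n = trans (cong (1# +_) (fromℕ-+ m n)) (sym (+-assoc 1# (fromℕ m) (fromℕ n)))

  fromℕ-* : ∀ m n → fromℕ (m ℕ.* n) ≡ fromℕ m * fromℕ n
  fromℕ-* zero    n = sym (zeroˡ (fromℕ n))
  fromℕ-* (suc m) n = begin-equality
    fromℕ (n ℕ.+ m ℕ.* n)           ≡⟨ fromℕ-+ n (m ℕ.* n) ⟩
    fromℕ n + fromℕ (m ℕ.* n)       ≡⟨ cong (fromℕ n +_) (fromℕ-* m n) ⟩
    fromℕ n + fromℕ m * fromℕ n     ≡⟨ solve 2 (λ n m → n :+ m :* n := (con 1 :+ m) :* n) refl (fromℕ n) (fromℕ m) ⟩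
    fromℕ (suc m) * fromℕ n         ∎

-- Finite additivity and integrals of simple functions.

module ProbabilityProperties (reals : RealNumbers) where

  open RealNumbers reals
  open OrderedFieldProperties orderedField
  open Probability reals

  sumℝ-map-++ : ∀ {A : Set} (f : A → ℝ) xs ys →
                sumℝ (map f (xs ++ ys)) ≡ sumℝ (map f xs) + sumℝ (map f ys)
  sumℝ-map-++ f []       ys = sym (+-identityˡ _)
  sumℝ-map-++ f (x ∷ xs) ys = trans (cong (f x +_) (sumℝ-map-++ f xs ys)) (sym (+-assoc _ _ _))

  fromℕ-sumBy : ∀ {A : Set} {f : A → ℕ} {g : A → ℝ} xs → (∀ x → fromℕ (f x) ≤ g x) →
                fromℕ (sumBy f xs) ≤ sumℝ (map g xs)
  fromℕ-sumBy         []       f≤g = ≤-refl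
  fromℕ-sumBy {f = f} (x ∷ xs) f≤g =
    ≤-trans (≤-reflexive (fromℕ-+ (f x) (sumBy f xs))) (+-mono-≤ (f≤g x) (fromℕ-sumBy xs f≤g))

  -- A first value below `c` can be discarded without lowering the average of the rest below `c`.
  average-∷-≤ : ∀ {A : Set} c (g : A → ℝ) x xs →
              fromℕ (suc (length xs)) * c ≤ g x + sumℝ (map g xs) → ∃ λ y → c ≤ g y
  average-∷-≤ c g x [] le =
    x , subst₂ _≤_ (trans (cong (_* c) (+-identityʳ 1#)) (*-identityˡ c)) (+-identityʳ (g x)) le
  average-∷-≤ c g x (y ∷ ys) le with ≤-<-connex c (g x)
  ... | inj₁ c≤gx = x , c≤gx
  ... | inj₂ gx<c = average-∷-≤ c g y ys (+-cancelʳ-≤ c (begin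
    l * c + c                              ≡⟨ solve 2 (λ l c → l :* c :+ c := (con 1 :+ l) :* c) refl l c ⟩
    (1# + l) * c                           ≤⟨ le ⟩
    g x + (g y + sumℝ (map g ys))          ≤⟨ +-monoˡ-≤ _ (<⇒≤ gx<c) ⟩
    c + (g y + sumℝ (map g ys))            ≡⟨ +-comm c _ ⟩
    (g y + sumℝ (map g ys)) + c            ∎))
    where
    open ≤-Reasoning
    open Solver using (solve; _:=_; _:+_; _:*_; con)
    l = fromℕ (suc (length ys))

  average-≤ : ∀ {A : Set} c (g : A → ℝ) xs → 0 ℕ.< length xs →
              fromℕ (length xs) * c ≤ sumℝ (map g xs) → ∃ λ x → c ≤ g x
  average-≤ c g (x ∷ xs) _ = average-∷-≤ c g x xs

  module _ (space : ProbabilitySpace) where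

    open ProbabilitySpace space
    open SimpleFunction

    ∅ : Event
    ∅ = const false

    _∩_ _∪_ : Event → Event → Event
    (A ∩ B) ω = A ω ∧ B ω
    (A ∪ B) ω = A ω ∨ B ω

    -- The axioms speak of sequences of events, so two events are padded with empty ones.
    pair : Event → Event → ℕ → Event
    pair A B 0             = A
    pair A B 1             = B
    pair A B (suc (suc _)) = ∅

    isUnion-pair : ∀ {A B U} → (∀ ω → U ω ≡ (A ∪ B) ω) → IsUnion (pair A B) U
    isUnion-pair {A} {B} {U} U≗A∪B ω with A ω in a | B ω in b | U ω | U≗A∪B ω
    ... | true  | _     | _ | refl = mk⇔ (λ _ → 0 , subst T (sym a) tt) (λ _ → tt)
    ... | false | true  | _ | refl = mk⇔ (λ _ → 1 , subst T (sym b) tt) (λ _ → tt)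
    ... | false | false | _ | refl = mk⇔ (λ ()) λ where
      (0 , p) → subst T a p
      (1 , p) → subst T b p

    measurable-∅ : Measurable ∅
    measurable-∅ = measurable-complement measurable-full

    measurable-pair : ∀ {A B} → Measurable A → Measurable B → ∀ n → Measurable (pair A B n)
    measurable-pair mA mB 0             = mA
    measurable-pair mA mB 1             = mB
    measurable-pair mA mB (suc (suc n)) = measurable-∅

    -- The union is any `U` with the right values, because events that agree pointwise need not be
    -- propositionally equal.
    measurable-∪ : ∀ {A B U} → Measurable A → Measurable B → (∀ ω → U ω ≡ (A ∪ B) ω) → Measurable U
    measurable-∪ mA mB eq = measurable-union (measurable-pair mA mB) (isUnion-pair eq)

    measurable-∩ : ∀ {A B} → Measurable A → Measurable B → Measurable (A ∩ B)
    measurable-∩ {A} {B} mA mB =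
      measurable-∪ (measurable-complement
                      (measurable-∪ {U = λ ω → not (A ω) ∨ not (B ω)}
                        (measurable-complement mA) (measurable-complement mB) (λ _ → refl)))
                   measurable-∅ deMorgan
      where
      deMorgan : ∀ ω → A ω ∧ B ω ≡ not (not (A ω) ∨ not (B ω)) ∨ false
      deMorgan ω with A ω | B ω
      ... | true  | true  = refl
      ... | true  | false = refl
      ... | false | _     = refl

    -- The empty event is a disjoint union of copies of itself, so already the partial sum of two
    -- copies is at most `ℙ ∅`.
    ℙ-∅ : ℙ ∅ ≡ 0#
    ℙ-∅ = ≤-antisym p≤0 (ℙ-nonNegative measurable-∅)
      where
      p = ℙ ∅
      p+p≤p : p + (p + 0#) ≤ p
      p+p≤p = proj₁ (ℙ-additive {λ _ → ∅} {∅} (λ _ → measurable-∅) (λ _ _ _ _ → proj₁)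
                       (λ _ → mk⇔ (λ ()) proj₂)) _ (2 , refl)
      p≤0 : p ≤ 0#
      p≤0 = +-cancelʳ-≤ p (subst₂ _≤_ (cong (p +_) (+-identityʳ p)) (sym (+-identityˡ p)) p+p≤p)

    -- The partial sums are constant from the second one on and smaller before, so the supremum is
    -- attained.
    ℙ-∪ : ∀ {A B U} → Measurable A → Measurable B → (∀ ω → T (A ω) → ¬ T (B ω)) →
          (∀ ω → U ω ≡ (A ∪ B) ω) → ℙ U ≡ ℙ A + ℙ B
    ℙ-∪ {A} {B} {U} mA mB disj eq = ≤-antisym (least _ upper) (bound _ (2 , sum₂ 0))
      where
      disjoint : Disjoint (pair A B)
      disjoint 0             0             i≢j ω _       = i≢j refl
      disjoint 0             1             i≢j ω (p , q) = disj ω p q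
      disjoint 1             0             i≢j ω (p , q) = disj ω q p
      disjoint 1             1             i≢j ω _       = i≢j refl
      disjoint 0             (suc (suc _)) i≢j ω (_ , ())
      disjoint 1             (suc (suc _)) i≢j ω (_ , ())
      disjoint (suc (suc _)) _             i≢j ω (() , _)

      additive = ℙ-additive (measurable-pair mA mB) disjoint (isUnion-pair eq)
      bound    = proj₁ additive
      least    = proj₂ additive

      tail : ∀ n (g : ℕ → ℕ) → (∀ i → ℙ (pair A B (g i)) ≡ 0#) →
             sumℝ (map (ℙ ∘ pair A B) (applyUpTo g n)) ≡ 0#
      tail zero    g g≡0 = refl
      tail (suc n) g g≡0 = trans (cong₂ _+_ (g≡0 0) (tail n (g ∘ suc) (g≡0 ∘ suc))) (+-identityʳ 0#)

      sum₂ : ∀ n → ℙ A + ℙ B ≡ sumℝ (map (ℙ ∘ pair A B) (upTo (suc (suc n))))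
      sum₂ n = cong (ℙ A +_) (sym (trans (cong (ℙ B +_) (tail n _ (λ _ → ℙ-∅))) (+-identityʳ (ℙ B))))

      upper : IsUpperBound (λ x → ∃ λ n → x ≡ sumℝ (map (ℙ ∘ pair A B) (upTo n))) (ℙ A + ℙ B)
      upper _ (0 , refl)           = ≤-trans (ℙ-nonNegative mA) (x≤x+y (ℙ-nonNegative mB))
      upper _ (1 , refl)           = +-monoʳ-≤ (ℙ A) (ℙ-nonNegative mB)
      upper _ (suc (suc n) , refl) = ≤-reflexive (sym (sum₂ n))

    -- The notion of union sees events only through their values, so `B` is also a union of `A` and
    -- the empty event; additivity then fixes its probability.
    ℙ-cong : ∀ {A B} → Measurable A → (∀ ω → B ω ≡ A ω) → ℙ B ≡ ℙ A
    ℙ-cong {A} {B} mA eq =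
      trans (ℙ-∪ mA measurable-∅ (λ _ _ ()) eq′) (trans (cong (ℙ A +_) ℙ-∅) (+-identityʳ (ℙ A)))
      where
      eq′ : ∀ ω → B ω ≡ A ω ∨ false
      eq′ ω with A ω | eq ω
      ... | true  | e = e
      ... | false | e = e

    ℙ-split : ∀ {A E} → Measurable A → Measurable E → ℙ A ≡ ℙ (A ∩ E) + ℙ (A ∩ (not ∘ E))
    ℙ-split {A} {E} mA mE =
      ℙ-∪ (measurable-∩ mA mE) (measurable-∩ mA (measurable-complement mE)) disj eq
      where
      disj : ∀ ω → T (A ω ∧ E ω) → ¬ T (A ω ∧ not (E ω))
      disj ω p q with A ω | E ω
      ... | true | true = q
      ... | true | false = p
      eq : ∀ ω → A ω ≡ (A ω ∧ E ω) ∨ (A ω ∧ not (E ω))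
      eq ω with A ω | E ω
      ... | true  | true  = refl
      ... | true  | false = refl
      ... | false | _     = refl

    Terms : Set
    Terms = List (ℝ × Event)

    -- Versions of `value` and `integral` for bare lists of terms, the integral relative to an
    -- event, so that an induction can drop a term while it shrinks the event.
    valueOf : Terms → Ω → ℝ
    valueOf ts ω = sumℝ (map (λ t → if proj₂ t ω then proj₁ t else 0#) ts)

    integralOn : Event → Terms → ℝ
    integralOn A ts = sumℝ (map (λ t → proj₁ t * ℙ (proj₂ t ∩ A)) ts)

    integralOn-split : ∀ {A E} ts → All (λ t → Measurable (proj₂ t)) ts → Measurable A → Measurable E →
      integralOn A ts ≡ integralOn (A ∩ E) ts + integralOn (A ∩ (not ∘ E)) ts
    integralOn-split []             []        mA mE = sym (+-identityʳ 0#)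
    integralOn-split {A} {E} ((a , B) ∷ ts) (mB ∷ ms) mA mE = begin-equality
      a * ℙ (B ∩ A) + integralOn A ts
        ≡⟨ cong₂ (λ x y → a * x + y) split (integralOn-split ts ms mA mE) ⟩
      a * (p + q) + (r + s)
        ≡⟨ solve 5 (λ a p q r s → a :* (p :+ q) :+ (r :+ s) := (a :* p :+ r) :+ (a :* q :+ s)) refl a p q r s ⟩
      (a * p + r) + (a * q + s) ∎
      where
      open ≤-Reasoning
      open Solver using (solve; _:=_; _:+_; _:*_)
      p = ℙ (B ∩ (A ∩ E))
      q = ℙ (B ∩ (A ∩ (not ∘ E)))
      r = integralOn (A ∩ E) ts
      s = integralOn (A ∩ (not ∘ E)) ts
      assoc : ∀ (C : Event) ω → (B ω ∧ A ω) ∧ C ω ≡ B ω ∧ (A ω ∧ C ω)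
      assoc C ω with B ω
      ... | true  = refl
      ... | false = refl
      mE′ = measurable-complement mE
      split : ℙ (B ∩ A) ≡ p + q
      split = trans (ℙ-split (measurable-∩ mB mA) mE)
        (cong₂ _+_ (ℙ-cong (measurable-∩ mB (measurable-∩ mA mE)) (assoc E))
                   (ℙ-cong (measurable-∩ mB (measurable-∩ mA mE′)) (assoc (not ∘ E))))

    -- Induction on the terms: the first event splits A into a part on which the remaining
    -- terms still have to contribute c − a and a part on which they have to contribute c.
    integralOn-≥ : ∀ {A} c ts → All (λ t → Measurable (proj₂ t)) ts → Measurable A →
      (∀ ω → T (A ω) → c ≤ valueOf ts ω) → c * ℙ A ≤ integralOn A ts
    -- With no terms left, an outcome in `A` would force `c ≤ 0#`; for positive `c` the event is
    -- therefore empty.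
    integralOn-≥ {A} c [] [] mA c≤ with c ≤? 0#
    ... | yes c≤0 = subst (c * ℙ A ≤_) (zeroˡ (ℙ A)) (*-monoʳ-≤ (ℙ-nonNegative mA) c≤0)
    ... | no  c≰0 = ≤-reflexive (trans (cong (c *_) (trans (ℙ-cong measurable-∅ empty) ℙ-∅)) (zeroʳ c))
      where
      empty : ∀ ω → A ω ≡ false
      empty ω with A ω | c≤ ω
      ... | true  | c≤0 = ⊥-elim (c≰0 (c≤0 tt))
      ... | false | _   = refl
    integralOn-≥ {A} c ((a , E) ∷ ts) (mE ∷ ms) mA c≤ = begin
      c * ℙ A
        ≡⟨ cong (c *_) (ℙ-split mA mE) ⟩
      -- `c` is opened as `c - a + a` so that the solver for commutative semirings can treat `c - a`
      -- as an atom.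
      c * (p + q)
        ≡⟨ cong (λ x → x * (p + q)) (-‿+-cancel c a) ⟨
      (c - a + a) * (p + q)
        ≡⟨ solve 4 (λ d a p q → (d :+ a) :* (p :+ q) := a :* p :+ (d :* p :+ (d :+ a) :* q)) refl (c - a) a p q ⟩
      a * p + ((c - a) * p + (c - a + a) * q)
        ≡⟨ cong (λ x → a * p + ((c - a) * p + x * q)) (-‿+-cancel c a) ⟩
      a * p + ((c - a) * p + c * q)
        ≤⟨ +-monoʳ-≤ (a * p) (+-mono-≤ (integralOn-≥ (c - a) ts ms (measurable-∩ mA mE) on-E)
                                         (integralOn-≥ c ts ms (measurable-∩ mA mE′) off-E)) ⟩
      a * p + (integralOn (A ∩ E) ts + integralOn (A ∩ (not ∘ E)) ts)
        ≡⟨ cong₂ (λ x y → a * x + y) (ℙ-cong (measurable-∩ mA mE) comm) (integralOn-split ts ms mA mE) ⟨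
      a * ℙ (E ∩ A) + integralOn A ts ∎
      where
      open ≤-Reasoning
      open Solver using (solve; _:=_; _:+_; _:*_)
      mE′ = measurable-complement mE
      p = ℙ (A ∩ E)
      q = ℙ (A ∩ (not ∘ E))
      comm : ∀ ω → E ω ∧ A ω ≡ A ω ∧ E ω
      comm ω with A ω | E ω
      ... | true  | true  = refl
      ... | true  | false = refl
      ... | false | true  = refl
      ... | false | false = refl
      on-E : ∀ ω → T (A ω ∧ E ω) → c - a ≤ valueOf ts ω
      on-E ω t with A ω | E ω | c≤ ω
      ... | true | true | c≤a+v = +-cancelʳ-≤ a
        (subst₂ _≤_ (sym (-‿+-cancel c a)) (+-comm a (valueOf ts ω)) (c≤a+v tt))
      off-E : ∀ ω → T (A ω ∧ not (E ω)) → c ≤ valueOf ts ω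
      off-E ω t with A ω | E ω | c≤ ω
      ... | true | false | c≤0+v = subst (c ≤_) (+-identityˡ (valueOf ts ω)) (c≤0+v tt)

    -- The form of monotonicity on which the argument rests: a pointwise bound for all draws
    -- together becomes a bound for their integrals.
    integral-≥ : ∀ c (φ : SimpleFunction) → (∀ ω → c ≤ value φ ω) → c ≤ integral φ
    integral-≥ c φ c≤φ = subst₂ _≤_ (trans (cong (c *_) ℙ-full) (*-identityʳ c)) (on-full (terms φ) (measurable φ))
      (integralOn-≥ c (terms φ) (measurable φ) measurable-full (λ ω _ → c≤φ ω))
      where
      on-full : ∀ ts → All (λ t → Measurable (proj₂ t)) ts →
                integralOn (const true) ts ≡ sumℝ (map (λ t → proj₁ t * ℙ (proj₂ t)) ts)
      on-full []             []        = refl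
      on-full ((a , E) ∷ ts) (mE ∷ ms) =
        cong₂ (λ x y → a * x + y) (ℙ-cong mE (λ ω → ∧-identityʳ (E ω))) (on-full ts ms)

    0ˢ : SimpleFunction
    0ˢ = record { terms = [] ; nonNegative = [] ; measurable = [] }

    infixl 6 _+ˢ_
    _+ˢ_ : SimpleFunction → SimpleFunction → SimpleFunction
    φ +ˢ ψ = record
      { terms       = terms φ ++ terms ψ
      ; nonNegative = Allₚ.++⁺ (nonNegative φ) (nonNegative ψ)
      ; measurable  = Allₚ.++⁺ (measurable φ) (measurable ψ)
      }

    value-+ˢ : ∀ φ ψ ω → value (φ +ˢ ψ) ω ≡ value φ ω + value ψ ω
    value-+ˢ φ ψ ω = sumℝ-map-++ _ (terms φ) (terms ψ)

    integral-+ˢ : ∀ φ ψ → integral (φ +ˢ ψ) ≡ integral φ + integral ψ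
    integral-+ˢ φ ψ = sumℝ-map-++ _ (terms φ) (terms ψ)

    sumˢ : List SimpleFunction → SimpleFunction
    sumˢ = foldr _+ˢ_ 0ˢ

    value-sumˢ : ∀ φs ω → value (sumˢ φs) ω ≡ sumℝ (map (λ φ → value φ ω) φs)
    value-sumˢ []       ω = refl
    value-sumˢ (φ ∷ φs) ω = trans (value-+ˢ φ (sumˢ φs) ω) (cong (value φ ω +_) (value-sumˢ φs ω))

    integral-sumˢ : ∀ φs → integral (sumˢ φs) ≡ sumℝ (map integral φs)
    integral-sumˢ []       = refl
    integral-sumˢ (φ ∷ φs) = trans (integral-+ˢ φ (sumˢ φs)) (cong (integral φ +_) (integral-sumˢ φs))

    module _ (X : Ω → ℝ) (rv : IsRandomVariable X) (level : ℕ → ℝ) where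

      exceeds : ℝ → Event
      exceeds c ω = not (does (X ω ≤? c))

      -- Its value is the number of `j < n` with `level j < X ω`. Counting down makes each staircase
      -- the previous one with one term in front.
      staircase : ℕ → SimpleFunction
      staircase n = record
        { terms       = map (λ j → 1# , exceeds (level j)) (downFrom n)
        ; nonNegative = Allₚ.map⁺ (All.universal (λ _ → 0≤1) (downFrom n))
        ; measurable  = Allₚ.map⁺ (All.universal (λ j → measurable-complement (rv (level j))) (downFrom n))
        }

      staircase-suc-< : ∀ {n ω} → level n < X ω → value (staircase (suc n)) ω ≡ 1# + value (staircase n) ω
      staircase-suc-< {n} {ω} lt rewrite dec-false (X ω ≤? level n) (<⇒≱ lt) = refl

      staircase-suc-≥ : ∀ {n ω} → X ω ≤ level n → value (staircase (suc n)) ω ≡ value (staircase n) ω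
      staircase-suc-≥ {n} {ω} le rewrite dec-true (X ω ≤? level n) le = +-identityˡ _

      staircase-≤-length : ∀ n ω → value (staircase n) ω ≤ fromℕ n
      staircase-≤-length zero    ω = ≤-refl
      staircase-≤-length (suc n) ω with ≤-<-connex (X ω) (level n)
      ... | inj₁ le = ≤-trans (≤-reflexive (staircase-suc-≥ {n} le))
        (≤-trans (staircase-≤-length n ω) (fromℕ-mono-≤ (ℕₚ.n≤1+n n)))
      ... | inj₂ gt = ≤-trans (≤-reflexive (staircase-suc-< {n} gt)) (+-monoʳ-≤ 1# (staircase-≤-length n ω))

      -- Consider the largest exceeded index `j`: at most `suc j` terms count, and `X` is at least
      -- `suc j` there.
      staircase-≤ : (∀ ω → 0# ≤ X ω) → (∀ ω j → level j < X ω → fromℕ (suc j) ≤ X ω) →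
                    ∀ n ω → value (staircase n) ω ≤ X ω
      staircase-≤ 0≤X step zero    ω = 0≤X ω
      staircase-≤ 0≤X step (suc n) ω with ≤-<-connex (X ω) (level n)
      ... | inj₁ le = ≤-trans (≤-reflexive (staircase-suc-≥ {n} le)) (staircase-≤ 0≤X step n ω)
      ... | inj₂ gt = ≤-trans (staircase-≤-length (suc n) ω) (step ω n gt)

      staircase-≥ : ∀ {n h} ω → h ℕ.≤ n → (∀ j → j ℕ.< h → level j < X ω) → fromℕ h ≤ value (staircase n) ω
      staircase-≥ {zero}          ω ℕ.z≤n above = ≤-refl
      staircase-≥ {suc n} {h} ω h≤1+n above with ℕₚ.m≤n⇒m<n∨m≡n h≤1+n
      ... | inj₁ (ℕ.s≤s h≤n) = ≤-trans (staircase-≥ {n} ω h≤n above) mono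
        where
        mono : value (staircase n) ω ≤ value (staircase (suc n)) ω
        mono with ≤-<-connex (X ω) (level n)
        ... | inj₁ le = ≤-reflexive (sym (staircase-suc-≥ {n} le))
        ... | inj₂ gt = subst (_≤ value (staircase (suc n)) ω) (+-identityˡ (value (staircase n) ω))
          (≤-trans (+-monoˡ-≤ (value (staircase n) ω) 0≤1) (≤-reflexive (sym (staircase-suc-< {n} gt))))
      ... | inj₂ refl = ≤-trans
        (+-monoʳ-≤ 1# (staircase-≥ {n} ω ℕₚ.≤-refl (λ j j<n → above j (ℕₚ.m<n⇒m<1+n j<n))))
        (≤-reflexive (sym (staircase-suc-< {n} (above n ℕₚ.≤-refl))))

module PackingProperties (reals : RealNumbers) where

  open RealNumbers reals
  open OrderedFieldProperties orderedField
  open BinPacking reals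
  open Cardinality ℕₚ._≟_

  -- Estimates for integrals of step functions.

  integrate : (ℝ → ℕ) → List ℝ → ℝ
  integrate f []           = 0#
  integrate f (p ∷ [])     = 0#
  integrate f (p ∷ q ∷ ps) = (q - p) * fromℕ (f p) + integrate f (q ∷ ps)

  -- Stated for an arbitrary `g` so that it applies to the function local to `stepIntegral`, for
  -- which the three equations hold by `refl`.
  integrate-unique : ∀ f (g : List ℝ → ℝ) → g [] ≡ 0# → (∀ p → g (p ∷ []) ≡ 0#) →
    (∀ p q ps → g (p ∷ q ∷ ps) ≡ (q - p) * fromℕ (f p) + g (q ∷ ps)) → ∀ ps → g ps ≡ integrate f ps
  integrate-unique f g g₀ g₁ g₂ []           = g₀
  integrate-unique f g g₀ g₁ g₂ (p ∷ [])     = g₁ p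
  integrate-unique f g g₀ g₁ g₂ (p ∷ q ∷ ps) =
    trans (g₂ p q ps) (cong ((q - p) * fromℕ (f p) +_) (integrate-unique f g g₀ g₁ g₂ (q ∷ ps)))

  -- The function local to stepIntegral cannot be named, but unification finds it.
  mutual
    stepIntegral-go : (ℝ → ℕ) → List ℝ → List ℝ → ℝ
    stepIntegral-go = _

    stepIntegral-sort : ∀ f points → stepIntegral f points ≡ stepIntegral-go f points (sort ≤-decTotalOrder points)
    stepIntegral-sort f points with sort ≤-decTotalOrder points
    ... | _ = refl

  stepIntegral-integrate : ∀ f points → stepIntegral f points ≡ integrate f (sort ≤-decTotalOrder points)
  stepIntegral-integrate f points = trans (stepIntegral-sort f points)
    (integrate-unique f (stepIntegral-go f points) refl (λ _ → refl) (λ _ _ _ → refl) (sort ≤-decTotalOrder points))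

  private
    Ascending : List ℝ → Set
    Ascending = AllPairs _≤_

    sort-ascending : ∀ ps → Ascending (sort ≤-decTotalOrder ps)
    sort-ascending ps = Linked⇒AllPairs ≤-trans (sort-↗ ≤-decTotalOrder ps)

    ∈-sort⁺ : ∀ {p ps} → p ∈ ps → p ∈ sort ≤-decTotalOrder ps
    ∈-sort⁺ {ps = ps} = ∈-resp-↭ (↭-sym (sort-↭ ≤-decTotalOrder ps))

    ∈-sort⁻ : ∀ {p ps} → p ∈ sort ≤-decTotalOrder ps → p ∈ ps
    ∈-sort⁻ {ps = ps} = ∈-resp-↭ (sort-↭ ≤-decTotalOrder ps)

    telescope : ∀ {p q r} x → (q - p) * x + (r - q) * x ≡ (r - p) * x
    telescope {p} {q} {r} x = trans (sym (distribʳ x (q - p) (r - q))) (cong (_* x) (+-cancelʳ-≡ p (begin-equality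
      q - p + (r - q) + p    ≡⟨ solve 4 (λ q r -p p → q :+ -p :+ r :+ p := r :+ ((q :+ -p) :+ p))
                                   refl q (r - q) (- p) p ⟩
      r - q + (q - p + p)    ≡⟨ cong (r - q +_) (-‿+-cancel q p) ⟩
      r - q + q              ≡⟨ -‿+-cancel r q ⟩
      r                      ≡⟨ -‿+-cancel r p ⟨
      r - p + p              ∎)))
      where
      open ≤-Reasoning
      open Solver using (solve; _:=_; _:+_)

    vanish : ∀ {p x} → (p - p) * x ≡ 0#
    vanish {p} {x} = trans (cong (_* x) (-‿inverseʳ p)) (zeroˡ x)

  integrate-nonNegative : ∀ f {ps} → Ascending ps → 0# ≤ integrate f ps
  integrate-nonNegative f []                       = ≤-refl
  integrate-nonNegative f (_ ∷ [])                 = ≤-refl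
  integrate-nonNegative f {p ∷ _} ((p≤q ∷ _) ∷ as@(_ ∷ _)) =
    ≤-trans (*-nonNegative (x≤y⇒0≤y-x p≤q) (0≤fromℕ (f p))) (x≤x+y (integrate-nonNegative f as))

  integrate-≥-head : ∀ f h {p b ps} → Ascending (p ∷ ps) → b ∈ p ∷ ps →
    (∀ t → p ≤ t → t < b → h ℕ.≤ f t) → (b - p) * fromℕ h ≤ integrate f (p ∷ ps)
  integrate-≥-head f h as (here refl) h≤f = ≤-trans (≤-reflexive vanish) (integrate-nonNegative f as)
  -- Points may be repeated: `b` can stand further down and still equal `p`, and then `h≤f` says
  -- nothing about `f p`.
  integrate-≥-head f h {p} {b} {q ∷ ps} as@((p≤q ∷ p≤ps) ∷ as′) (there b∈) h≤f with p ≟ b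
  ... | yes refl = ≤-trans (≤-reflexive vanish) (integrate-nonNegative f as)
  ... | no  p≢b  = begin
    (b - p) * fromℕ h                             ≡⟨ telescope (fromℕ h) ⟨
    (q - p) * fromℕ h + (b - q) * fromℕ h         ≤⟨ +-mono-≤
      (*-monoˡ-≤ (x≤y⇒0≤y-x p≤q) (fromℕ-mono-≤ (h≤f p ≤-refl (All.lookup (p≤q ∷ p≤ps) b∈ , p≢b))))
      (integrate-≥-head f h as′ b∈ (λ t q≤t → h≤f t (≤-trans p≤q q≤t))) ⟩
    (q - p) * fromℕ (f p) + integrate f (q ∷ ps)  ∎
    where open ≤-Reasoning

  integrate-≥ : ∀ f h {a b ps} → Ascending ps → a ∈ ps → b ∈ ps → a ≤ b →
    (∀ t → a ≤ t → t < b → h ℕ.≤ f t) → (b - a) * fromℕ h ≤ integrate f ps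
  integrate-≥ f h as (here refl) b∈ a≤b h≤f = integrate-≥-head f h as b∈ h≤f
  integrate-≥ f h {a} as@(p≤ ∷ _) (there a∈) (here refl) a≤b h≤f = ≤-trans
    (≤-reflexive (trans (cong (λ x → (x - a) * fromℕ h) (≤-antisym (All.lookup p≤ a∈) a≤b)) vanish))
    (integrate-nonNegative f as)
  integrate-≥ f h {ps = p ∷ q ∷ ps} ((p≤q ∷ _) ∷ as) (there a∈) (there b∈) a≤b h≤f = begin
    _                                             ≤⟨ integrate-≥ f h as a∈ b∈ a≤b h≤f ⟩
    integrate f (q ∷ ps)                          ≡⟨ +-identityˡ _ ⟨
    0# + integrate f (q ∷ ps)                     ≤⟨ +-monoˡ-≤ _ (*-nonNegative (x≤y⇒0≤y-x p≤q) (0≤fromℕ (f p))) ⟩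
    (q - p) * fromℕ (f p) + integrate f (q ∷ ps)  ∎
    where open ≤-Reasoning

  stepIntegral-nonNegative : ∀ f ps → 0# ≤ stepIntegral f ps
  stepIntegral-nonNegative f ps rewrite stepIntegral-integrate f ps = integrate-nonNegative f (sort-ascending ps)

  stepIntegral-≥ : ∀ f h {a b ps} → a ∈ ps → b ∈ ps → a ≤ b →
    (∀ t → a ≤ t → t < b → h ℕ.≤ f t) → (b - a) * fromℕ h ≤ stepIntegral f ps
  stepIntegral-≥ f h {ps = ps} a∈ b∈ a≤b h≤f rewrite stepIntegral-integrate f ps =
    integrate-≥ f h (sort-ascending ps) (∈-sort⁺ a∈) (∈-sort⁺ b∈) a≤b h≤f

  module _ (f : ℝ → ℕ) {c₁ c₂ : ℕ} {v w : ℝ}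
           (f≤c₁ : ∀ t → f t ℕ.≤ c₁) (f≤c₂ : ∀ t → v ≤ t → f t ℕ.≤ c₂) where

    integrate-≤-after : ∀ {p ps} → Ascending (p ∷ ps) → v ≤ p → All (_≤ w) (p ∷ ps) →
                        integrate f (p ∷ ps) ≤ (w - p) * fromℕ c₂
    integrate-≤-after {p} {[]} as v≤p (p≤w ∷ []) = *-nonNegative (x≤y⇒0≤y-x p≤w) (0≤fromℕ c₂)
    integrate-≤-after {p} {q ∷ ps} ((p≤q ∷ _) ∷ as) v≤p (_ ∷ ≤w) = begin
      (q - p) * fromℕ (f p) + integrate f (q ∷ ps)  ≤⟨ +-mono-≤
        (*-monoˡ-≤ (x≤y⇒0≤y-x p≤q) (fromℕ-mono-≤ (f≤c₂ p v≤p)))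
        (integrate-≤-after as (≤-trans v≤p p≤q) ≤w) ⟩
      (q - p) * fromℕ c₂ + (w - q) * fromℕ c₂       ≡⟨ telescope (fromℕ c₂) ⟩
      (w - p) * fromℕ c₂                            ∎
      where open ≤-Reasoning

    -- It matters that `v` is one of the points: an interval with `v` in its interior would be
    -- charged with the value at its left end, for which only `c₁` is available.
    integrate-≤ : ∀ {p ps} → Ascending (p ∷ ps) → v ∈ p ∷ ps → All (_≤ w) (p ∷ ps) →
                  integrate f (p ∷ ps) ≤ (v - p) * fromℕ c₁ + (w - v) * fromℕ c₂
    integrate-≤ {p} {ps} as (here refl) ≤w = begin
      integrate f (p ∷ ps)                             ≤⟨ integrate-≤-after as ≤-refl ≤w ⟩
      (w - p) * fromℕ c₂                               ≡⟨ +-identityˡ _ ⟨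
      0# + (w - p) * fromℕ c₂                          ≡⟨ cong (_+ (w - p) * fromℕ c₂) vanish ⟨
      (p - p) * fromℕ c₁ + (w - p) * fromℕ c₂          ∎
      where open ≤-Reasoning
    integrate-≤ {p} {q ∷ ps} ((p≤q ∷ _) ∷ as) (there v∈) (_ ∷ ≤w) = begin
      (q - p) * fromℕ (f p) + integrate f (q ∷ ps)
        ≤⟨ +-mono-≤ (*-monoˡ-≤ (x≤y⇒0≤y-x p≤q) (fromℕ-mono-≤ (f≤c₁ p))) (integrate-≤ as v∈ ≤w) ⟩
      (q - p) * fromℕ c₁ + ((v - q) * fromℕ c₁ + (w - v) * fromℕ c₂)
        ≡⟨ +-assoc _ _ _ ⟨
      (q - p) * fromℕ c₁ + (v - q) * fromℕ c₁ + (w - v) * fromℕ c₂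
        ≡⟨ cong (_+ (w - v) * fromℕ c₂) (telescope (fromℕ c₁)) ⟩
      (v - p) * fromℕ c₁ + (w - v) * fromℕ c₂
        ∎
      where open ≤-Reasoning

    stepIntegral-≤ : ∀ {u ps} → v ∈ ps → (∀ {p} → p ∈ ps → u ≤ p × p ≤ w) →
                     stepIntegral f ps ≤ (v - u) * fromℕ c₁ + (w - v) * fromℕ c₂
    stepIntegral-≤ {u} {ps} v∈ps bounds
      rewrite stepIntegral-integrate f ps
      with bounds′ ← All.tabulate {xs = sort ≤-decTotalOrder ps} (bounds ∘ ∈-sort⁻)
      with sort ≤-decTotalOrder ps | sort-ascending ps | ∈-sort⁺ v∈ps | bounds′
    ... | p ∷ qs | as | v∈ | bs@((u≤p , _) ∷ _) = ≤-trans
      (integrate-≤ as v∈ (All.map proj₂ bs))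
      (+-monoˡ-≤ _ (*-monoʳ-≤ (0≤fromℕ c₁) (+-monoʳ-≤ v (-‿antitone u≤p))))

  -- Optimal packings of items of size 1/k.

  module EqualSizes (k′ : ℕ) where

    k : ℕ
    k = suc k′

    σ : ℝ
    σ = fromℕ k ⁻¹

    0<k : 0# < fromℕ k
    0<k = 0<fromℕ-suc k′

    kσ≡1 : fromℕ k * σ ≡ 1#
    kσ≡1 = ⁻¹-inverse (fromℕ k) (>⇒≢0 0<k)

    0<σ : 0# < σ
    0<σ = ⁻¹-positive 0<k

    σ≤1 : σ ≤ 1#
    σ≤1 = subst₂ _≤_ (*-identityˡ σ) kσ≡1 (*-monoʳ-≤ (<⇒≤ 0<σ) (x≤x+y (0≤fromℕ k′)))

    load-count : ∀ b (p : Packing) → All (λ xc → size (proj₁ xc) ≡ σ) p →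
                 load b p ≡ fromℕ (count b (map proj₂ p)) * σ
    load-count b []            []          = sym (zeroˡ σ)
    load-count b ((x , c) ∷ p) (x≡σ ∷ ≡σ) with c ℕₚ.≟ b
    ... | yes refl = begin-equality
      load b ((x , b) ∷ p)
        ≡⟨ cong (sumℝ ∘ map (size ∘ proj₁)) (filter-accept (λ xc → proj₂ xc ℕₚ.≟ b) {x , b} {p} refl) ⟩
      size x + load b p
        ≡⟨ cong₂ _+_ x≡σ (load-count b p ≡σ) ⟩
      σ + fromℕ (count b (map proj₂ p)) * σ
        ≡⟨ solve 2 (λ s n → s :+ n :* s := (con 1 :+ n) :* s) refl σ (fromℕ (count b (map proj₂ p))) ⟩
      fromℕ (1 ℕ.+ count b (map proj₂ p)) * σ
        ≡⟨ cong (λ d → fromℕ (d ℕ.+ count b (map proj₂ p)) * σ) (δ-refl b) ⟨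
      fromℕ (δ b b ℕ.+ count b (map proj₂ p)) * σ
        ∎
      where
      open ≤-Reasoning
      open Solver using (solve; _:=_; _:+_; _:*_; con)
    ... | no  c≢b  = begin-equality
      load b ((x , c) ∷ p)
        ≡⟨ cong (sumℝ ∘ map (size ∘ proj₁)) (filter-reject (λ xc → proj₂ xc ℕₚ.≟ b) {x , c} {p} c≢b) ⟩
      load b p
        ≡⟨ load-count b p ≡σ ⟩
      fromℕ (count b (map proj₂ p)) * σ
        ≡⟨ cong (λ d → fromℕ (d ℕ.+ count b (map proj₂ p)) * σ) (δ-≢ (c≢b ∘ sym)) ⟨
      fromℕ (δ b c ℕ.+ count b (map proj₂ p)) * σ
        ∎
      where open ≤-Reasoning

    feasible⇒count≤k : ∀ {p} → All (λ xc → size (proj₁ xc) ≡ σ) p → Feasible p →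
                       ∀ b → count b (map proj₂ p) ℕ.≤ k
    feasible⇒count≤k {p} ≡σ feasible b = fromℕ-cancel-≤ (*-cancelˡ-≤ 0<σ (begin
      σ * fromℕ (count b (map proj₂ p))   ≡⟨ *-comm σ _ ⟩
      fromℕ (count b (map proj₂ p)) * σ   ≡⟨ load-count b p ≡σ ⟨
      load b p                            ≤⟨ feasible b ⟩
      1#                                  ≡⟨ kσ≡1 ⟨
      fromℕ k * σ                         ≡⟨ *-comm (fromℕ k) σ ⟩
      σ * fromℕ k                         ∎))
      where open ≤-Reasoning

    count≤k⇒feasible : ∀ {p} → All (λ xc → size (proj₁ xc) ≡ σ) p →
                       (∀ b → count b (map proj₂ p) ℕ.≤ k) → Feasible p
    count≤k⇒feasible {p} ≡σ few b = begin
      load b p                            ≡⟨ load-count b p ≡σ ⟩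
      fromℕ (count b (map proj₂ p)) * σ   ≤⟨ *-monoʳ-≤ (<⇒≤ 0<σ) (fromℕ-mono-≤ (few b)) ⟩
      fromℕ k * σ                         ≡⟨ kσ≡1 ⟩
      1#                                  ∎
      where open ≤-Reasoning

    -- Full bins, labelled downwards so that the label is the recursion variable. Items beyond
    -- `c * k` are lost, whence the length condition in `pack-items`.
    pack : ℕ → List Item → Packing
    pack zero    xs = []
    pack (suc c) xs = map (_, c) (take k xs) ++ pack c (drop k xs)

    pack-items : ∀ c xs → length xs ℕ.≤ c ℕ.* k → map proj₁ (pack c xs) ≡ xs
    pack-items zero    []       _   = refl
    pack-items (suc c) xs       len = begin
      map proj₁ (map (_, c) (take k xs) ++ pack c (drop k xs))
        ≡⟨ map-++ proj₁ (map (_, c) (take k xs)) _ ⟩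
      map proj₁ (map (_, c) (take k xs)) ++ map proj₁ (pack c (drop k xs))
        ≡⟨ cong₂ _++_ (trans (sym (map-∘ (take k xs))) (map-id (take k xs))) (pack-items c (drop k xs) shorter) ⟩
      take k xs ++ drop k xs
        ≡⟨ take++drop≡id k xs ⟩
      xs ∎
      where
      open ≡-Reasoning
      shorter : length (drop k xs) ℕ.≤ c ℕ.* k
      shorter = subst (ℕ._≤ c ℕ.* k) (sym (length-drop k xs)) (ℕₚ.m≤n+o⇒m∸n≤o (length xs) k len)

    pack-labels : ∀ c xs → map proj₂ (pack (suc c) xs) ≡ map (const c) (take k xs) ++ map proj₂ (pack c (drop k xs))
    pack-labels c xs = trans (map-++ proj₂ (map (_, c) (take k xs)) _)
                             (cong (_++ map proj₂ (pack c (drop k xs))) (sym (map-∘ (take k xs))))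

    pack-labels-< : ∀ c xs → All (ℕ._< c) (map proj₂ (pack c xs))
    pack-labels-< zero    xs = []
    pack-labels-< (suc c) xs rewrite pack-labels c xs =
      Allₚ.++⁺ (Allₚ.map⁺ (All.universal (λ _ → ℕₚ.n<1+n c) (take k xs)))
               (All.map ℕₚ.m<n⇒m<1+n (pack-labels-< c (drop k xs)))

    pack-count : ∀ c xs b → count b (map proj₂ (pack c xs)) ℕ.≤ k
    pack-count zero    xs b = ℕ.z≤n
    pack-count (suc c) xs b
      rewrite pack-labels c xs | sumBy-++ (δ b) (map (const c) (take k xs)) (map proj₂ (pack c (drop k xs)))
            | sumBy-map (δ b) (const c) (take k xs) | sumBy-const (δ b c) (take k xs)
      with b ℕₚ.≟ c
    ... | yes refl rewrite δ-refl b
                         | count-∉ (map proj₂ (pack c (drop k xs)))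
                             (All.map (λ y<c c≡y → ℕₚ.<⇒≢ y<c (sym c≡y)) (pack-labels-< c (drop k xs)))
                         | ℕₚ.+-identityʳ (length (take k xs) ℕ.* 1) | ℕₚ.*-identityʳ (length (take k xs))
                         | length-take k xs = ℕₚ.m⊓n≤m k (length xs)
    ... | no  b≢c  rewrite δ-≢ b≢c | ℕₚ.*-zeroʳ (length (take k xs)) = pack-count c (drop k xs) b

    pack-openBins : ∀ c xs → openBins (pack c xs) ℕ.≤ c
    pack-openBins c xs = subst (openBins (pack c xs) ℕ.≤_) (length-upTo c)
      (card-≤ (λ y∈ → ∈-upTo⁺ (All.lookup (pack-labels-< c xs) y∈)))

    ⌈_/k⌉ : ℕ → ℕ
    ⌈ m /k⌉ = (m ℕ.+ k′) ℕ./ k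

    ⌈/k⌉-upper : ∀ m → m ℕ.≤ ⌈ m /k⌉ ℕ.* k
    ⌈/k⌉-upper m = ℕₚ.+-cancelʳ-≤ k′ m _ (begin
      m ℕ.+ k′                                ≡⟨ ℕ.m≡m%n+[m/n]*n (m ℕ.+ k′) k ⟩
      (m ℕ.+ k′) ℕ.% k ℕ.+ ⌈ m /k⌉ ℕ.* k      ≤⟨ ℕₚ.+-monoˡ-≤ _ (ℕₚ.m<1+n⇒m≤n (ℕ.m%n<n (m ℕ.+ k′) k)) ⟩
      k′ ℕ.+ ⌈ m /k⌉ ℕ.* k                    ≡⟨ ℕₚ.+-comm k′ _ ⟩
      ⌈ m /k⌉ ℕ.* k ℕ.+ k′                    ∎)
      where open ℕₚ.≤-Reasoning

    ⌈/k⌉-least : ∀ {m c} → m ℕ.≤ c ℕ.* k → ⌈ m /k⌉ ℕ.≤ c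
    ⌈/k⌉-least {m} {c} m≤ck = ℕₚ.m<1+n⇒m≤n (ℕ.m<n*o⇒m/o<n (begin-strict
      m ℕ.+ k′            <⟨ ℕₚ.+-mono-≤-< m≤ck (ℕₚ.n<1+n k′) ⟩
      c ℕ.* k ℕ.+ k       ≡⟨ ℕₚ.+-comm (c ℕ.* k) k ⟩
      suc c ℕ.* k         ∎))
      where open ℕₚ.≤-Reasoning

    -- Read off from the packing instead of the ceiling, so that the minimum is attained by `refl`
    -- and the ceiling enters as an upper bound.
    minBins : List Item → ℕ
    minBins xs = openBins (pack ⌈ length xs /k⌉ xs)

    minBins-≤ : ∀ {c} xs → length xs ℕ.≤ c ℕ.* k → minBins xs ℕ.≤ c
    minBins-≤ xs len = ℕₚ.≤-trans (pack-openBins ⌈ length xs /k⌉ xs) (⌈/k⌉-least len)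

    length-≤-openBins : ∀ p → All (λ x → size x ≡ σ) (map proj₁ p) → Feasible p →
                        length (map proj₁ p) ℕ.≤ openBins p ℕ.* k
    length-≤-openBins p ≡σ feasible =
      subst (ℕ._≤ openBins p ℕ.* k) (trans (length-map proj₂ p) (sym (length-map proj₁ p)))
        (length-≤-count k {map proj₂ p} (feasible⇒count≤k {p} (Allₚ.map⁻ ≡σ) feasible) (∈-deduplicate⁺ ℕₚ._≟_))

    minBins-isMinBins : ∀ {xs} → All (λ x → size x ≡ σ) xs → IsMinBins xs (minBins xs)
    minBins-isMinBins {xs} ≡σ = (p , eq , feasible , refl) , least
      where
      p = pack ⌈ length xs /k⌉ xs
      eq : map proj₁ p ≡ xs
      eq = pack-items ⌈ length xs /k⌉ xs (⌈/k⌉-upper (length xs))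
      feasible : Feasible p
      feasible = count≤k⇒feasible {p} (Allₚ.map⁻ (subst (All _) (sym eq) ≡σ)) (pack-count ⌈ length xs /k⌉ xs)
      least : ∀ p → map proj₁ p ≡ xs → Feasible p → minBins xs ℕ.≤ openBins p
      least p refl feasible = minBins-≤ (map proj₁ p) (length-≤-openBins p ≡σ feasible)

  -- Logs, migrations and the bins they can empty.

  -- The part of the log up to time `t` when all items arrive at time 0: only migrations can be
  -- late. In contrast to `upToTime` it keeps the index `n`, so the bins of all items remain
  -- accessible.
  cut : ∀ {n} → ℝ → Log n → Log n
  cut t start            = start
  cut t l@(place _ _ _)  = l
  cut t l@(move l′ u _ _) = if does (u ≤? t) then l else cut t l′

  last-lookup : ∀ {A : Set} {n} (xs : Vec A (suc n)) → ∃ λ i → last xs ≡ lookup xs i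
  last-lookup {n = zero}  (x ∷ []) = Fin.zero , refl
  last-lookup {n = suc n} (x ∷ xs) with i , eq ← last-lookup xs = Fin.suc i , eq

  presentIn-[] : ∀ t (xs : Vec Item 0) → presentIn t xs [] ≡ []
  presentIn-[] t [] = refl

  module _ {n} (xs : Vec Item n) (arrival≡0 : ∀ i → arrival (lookup xs i) ≡ 0#) where

    packingAt-cut : ∀ {t} (l : Log n) → 0# ≤ t → LegalActions xs l →
                    packingAt t xs l ≡ presentIn t xs (bins (cut t l))
    packingAt-cut {t} start 0≤t _ = sym (presentIn-[] t xs)
    packingAt-cut {t} (place l u b) 0≤t (_ , _ , u≡ , _) with i , last≡ ← last-lookup xs
      rewrite dec-true (u ≤? t) (subst (_≤ t) (sym (trans u≡ (trans (cong arrival last≡) (arrival≡0 i)))) 0≤t)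
      = refl
    packingAt-cut {t} (move l u i b) 0≤t (legal , _) with does (u ≤? t)
    ... | true  = refl
    ... | false = packingAt-cut l 0≤t legal

    upToTime-cut : ∀ {t} (l : Log n) → 0# ≤ t → LegalActions xs l → upToTime t l ≡ (n , cut t l)
    upToTime-cut {t} start 0≤t _ = refl
    upToTime-cut {t} (place l u b) 0≤t (_ , _ , u≡ , _) with i , last≡ ← last-lookup xs
      rewrite dec-true (u ≤? t) (subst (_≤ t) (sym (trans u≡ (trans (cong arrival last≡) (arrival≡0 i)))) 0≤t)
      = refl
    upToTime-cut {t} (move l u i b) 0≤t (legal , _) with does (u ≤? t)
    ... | true  = refl
    ... | false = upToTime-cut l 0≤t legal

    0∈times : (l : Log n) → Fin n → LegalActions xs l → 0# ∈ times l
    0∈times (place l u b) _ (_ , _ , u≡ , _) with i , last≡ ← last-lookup xs =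
      here (sym (trans u≡ (trans (cong arrival last≡) (arrival≡0 i))))
    0∈times (move l u i b) j (legal , _) = there (0∈times l j legal)

  migrations-cut : ∀ {n} t (l : Log n) → migrations (cut t l) ℕ.≤ migrations l
  migrations-cut t start          = ℕ.z≤n
  migrations-cut t (place _ _ _)  = ℕₚ.≤-refl
  migrations-cut t (move l u _ _) with does (u ≤? t)
  ... | true  = ℕₚ.≤-refl
  ... | false = ℕₚ.m≤n⇒m≤1+n (migrations-cut t l)

  cut-cut : ∀ {n s t} (l : Log n) → s ≤ t → cut s (cut t l) ≡ cut s l
  cut-cut start          s≤t = refl
  cut-cut (place _ _ _)  s≤t = refl
  cut-cut {s = s} {t} (move l u i b) s≤t with u ≤? t
  ... | yes u≤t = refl
  ... | no  u≰t rewrite dec-false (u ≤? s) (λ u≤s → u≰t (≤-trans u≤s s≤t)) = cut-cut l s≤t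

  -- The other items keep their bins, so the former bin of `i` is the only label that can disappear.
  hits-update : ∀ {n} is (bs : Vec ℕ n) i b → hits (lookup bs) is ℕ.≤ suc (hits (lookup (bs [ i ]≔ b)) is)
  hits-update is bs i b =
    ℕₚ.≤-trans (card-mono {ys = lookup bs i ∷ map (lookup (bs [ i ]≔ b)) is} incl)
               (card-∷-≤ (lookup bs i) (map (lookup (bs [ i ]≔ b)) is))
    where
    incl : map (lookup bs) is ⊆ lookup bs i ∷ map (lookup (bs [ i ]≔ b)) is
    incl y∈ with j , j∈is , refl ← ∈-map⁻ (lookup bs) y∈ with i Finₚ.≟ j
    ... | yes refl = here refl
    ... | no  i≢j  = there (subst (_∈ map (lookup (bs [ i ]≔ b)) is) (lookup∘update′ (i≢j ∘ sym) bs b)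
                              (∈-map⁺ (lookup (bs [ i ]≔ b)) j∈is))

  hits-cut : ∀ {n} is s (l : Log n) →
             hits (lookup (bins (cut s l))) is ℕ.≤ hits (lookup (bins l)) is ℕ.+ migrations l
  hits-cut is s start         = ℕₚ.m≤m+n _ _
  hits-cut is s (place _ _ _) = ℕₚ.m≤m+n _ _
  hits-cut is s (move l u i b) with does (u ≤? s)
  ... | true  = ℕₚ.m≤m+n _ _
  ... | false = begin
    hits (lookup (bins (cut s l))) is                                 ≤⟨ hits-cut is s l ⟩
    hits (lookup (bins l)) is ℕ.+ migrations l                        ≤⟨ ℕₚ.+-monoˡ-≤ _ (hits-update is (bins l) i b) ⟩
    suc (hits (lookup (bins l [ i ]≔ b)) is) ℕ.+ migrations l         ≡⟨ ℕₚ.+-suc _ _ ⟨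
    hits (lookup (bins l [ i ]≔ b)) is ℕ.+ suc (migrations l)         ∎
    where open ℕₚ.≤-Reasoning

  hits-≤-openBins : ∀ {n} is t (xs : Vec Item n) bs → (∀ {i} → i ∈ is → Present t (lookup xs i)) →
                      hits (lookup bs) is ℕ.≤ openBins (presentIn t xs bs)
  hits-≤-openBins is t xs bs present = card-mono incl
    where
    incl : map (lookup bs) is ⊆ map proj₂ (presentIn t xs bs)
    incl y∈ with i , i∈is , refl ← ∈-map⁻ (lookup bs) y∈ =
      ∈-map⁺ proj₂ (∈-filter⁺ (present? t ∘ proj₁)
        (subst (_∈ toList (Vec.zip xs bs)) (lookup-zip i xs bs) (∈-toList⁺ (∈-lookup i (Vec.zip xs bs))))
        (present i∈is))

-- Vectors read as lists.

toList-tabulate : ∀ {A : Set} {n} (f : Fin n → A) → toList (Vec.tabulate f) ≡ List.tabulate f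
toList-tabulate {n = zero}  f = refl
toList-tabulate {n = suc n} f = cong (f Fin.zero ∷_) (toList-tabulate (f ∘ Fin.suc))

map-lookup-allFin : ∀ {A : Set} {n} (xs : Vec A n) → map (lookup xs) (allFin n) ≡ toList xs
map-lookup-allFin xs = trans (map-tabulate id (lookup xs))
  (trans (sym (toList-tabulate (lookup xs))) (cong toList (tabulate∘lookup xs)))

map-proj₁-zip : ∀ {A B : Set} {n} (xs : Vec A n) (ys : Vec B n) → map proj₁ (toList (Vec.zip xs ys)) ≡ toList xs
map-proj₁-zip []       []       = refl
map-proj₁-zip (x ∷ xs) (y ∷ ys) = cong (x ∷_) (map-proj₁-zip xs ys)

map-proj₂-zip : ∀ {A B : Set} {n} (xs : Vec A n) (ys : Vec B n) → map proj₂ (toList (Vec.zip xs ys)) ≡ toList ys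
map-proj₂-zip []       []       = refl
map-proj₂-zip (x ∷ xs) (y ∷ ys) = cong (y ∷_) (map-proj₂-zip xs ys)

length-filter-map : ∀ {A B : Set} {P : B → Set} (P? : Decidable P) (f : A → B) xs →
                    length (filter P? (map f xs)) ≡ length (filter (P? ∘ f) xs)
length-filter-map P? f []       = refl
length-filter-map P? f (x ∷ xs) with does (P? (f x))
... | true  = cong suc (length-filter-map P? f xs)
... | false = length-filter-map P? f xs

-- The random instances and their optimal cost.

module Adversary (reals : RealNumbers) (k′ : ℕ) (ε : RealNumbers.ℝ reals)
                 (0<ε : RealNumbers._<_ reals (RealNumbers.0# reals) ε) where

  open RealNumbers reals
  open OrderedFieldProperties orderedField
  open BinPacking reals
  open PackingProperties reals
  open EqualSizes k′
  open Cardinality ℕₚ._≟_ using (count; card-≤)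
  open Cardinality {Fin (k ℕ.* k)} Finₚ._≟_ using (length-unique-⊆)

  n : ℕ
  n = k ℕ.* k

  lifetime : Bool → ℝ
  lifetime survives = if survives then ε + 1# else ε

  ε≤lifetime : ∀ b → ε ≤ lifetime b
  ε≤lifetime true  = x≤x+y 0≤1
  ε≤lifetime false = ≤-refl

  lifetime≤ε+1 : ∀ b → lifetime b ≤ ε + 1#
  lifetime≤ε+1 true  = ≤-refl
  lifetime≤ε+1 false = x≤x+y 0≤1

  0<lifetime : ∀ b → 0# < lifetime b
  0<lifetime b = <-≤-trans 0<ε (ε≤lifetime b)

  item : Bool → Item
  item survives = record
    { arrival    = 0#
    ; size       = σ
    ; duration   = lifetime survives
    ; 0≤arrival  = ≤-refl
    ; 0≤size     = <⇒≤ 0<σ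
    ; size≤1     = σ≤1
    ; 0<duration = 0<lifetime survives
    }

  item-departure : ∀ b → departure (item b) ≡ lifetime b
  item-departure b = +-identityˡ (lifetime b)

  module _ (S : List (Fin n)) where

    itemOf : Fin n → Item
    itemOf i = item (does (any? (i Finₚ.≟_) S))

    arrival≡0 : ∀ i → arrival (lookup (Vec.tabulate itemOf) i) ≡ 0#
    arrival≡0 i = cong arrival (lookup∘tabulate itemOf i)

    adversary : Instance n
    adversary = record
      { items  = Vec.tabulate itemOf
      ; sorted = λ i j _ → ≤-reflexive (trans (arrival≡0 i) (sym (arrival≡0 j)))
      }

    itemList : List Item
    itemList = toList (items adversary)

    itemList≡tabulate : itemList ≡ List.tabulate itemOf
    itemList≡tabulate = toList-tabulate itemOf

    itemList≡map : itemList ≡ map itemOf (allFin n)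
    itemList≡map = trans itemList≡tabulate (sym (map-tabulate id itemOf))

    all-items : ∀ {P : Item → Set} → (∀ b → P (item b)) → All P itemList
    all-items {P} p = subst (All P) (sym itemList≡tabulate)
      (Allₚ.tabulate⁺ {f = itemOf} (λ i → p (does (any? (i Finₚ.≟_) S))))

    itemOf∈itemList : ∀ i → itemOf i ∈ itemList
    itemOf∈itemList i = subst (itemOf i ∈_) (sym itemList≡tabulate) (∈-tabulate⁺ {f = itemOf} i)

    survivor : ∀ {i} → i ∈ S → itemOf i ≡ item true
    survivor {i} i∈S = cong item (dec-true (any? (i Finₚ.≟_) S) i∈S)

    present-survivor : ∀ {i t} → i ∈ S → 0# ≤ t → t < ε + 1# → Present t (lookup (items adversary) i)
    present-survivor {i} {t} i∈S 0≤t t<ε+1 = subst (Present t) (sym (trans (lookup∘tabulate itemOf i) (survivor i∈S)))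
      (0≤t , subst (t <_) (sym (item-departure true)) t<ε+1)

    present-late : ∀ {i t} → ε ≤ t → Present t (itemOf i) → i ∈ S
    present-late {i} {t} ε≤t (_ , t<d) with any? (i Finₚ.≟_) S
    ... | yes i∈S = i∈S
    ... | no  _   = ⊥-elim (<⇒≱ t<d (subst (_≤ t) (sym (item-departure false)) ε≤t))

    ε+1∈departures : ∀ {i} → i ∈ S → ε + 1# ∈ map departure itemList
    ε+1∈departures {i} i∈S = subst (_∈ map departure itemList)
      (trans (cong departure (survivor i∈S)) (item-departure true)) (∈-map⁺ departure (itemOf∈itemList i))

    opt : ℝ → ℕ
    opt t = minBins (itemsAt t adversary)

    points : List ℝ
    points = map arrival itemList ++ map departure itemList

    OPT : ℝ
    OPT = stepIntegral opt points

    opt-isMinBins : ∀ t → IsMinBins (itemsAt t adversary) (opt t)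
    opt-isMinBins t = minBins-isMinBins (Allₚ.filter⁺ (present? t) (all-items (λ _ → refl)))

    OPT-isOPT : IsOPT adversary OPT
    OPT-isOPT = opt , opt-isMinBins , refl

    0∈points : Fin n → 0# ∈ points
    0∈points i = ∈-++⁺ˡ (∈-map⁺ arrival (itemOf∈itemList i))

    points-bounded : ∀ {p} → p ∈ points → 0# ≤ p × p ≤ ε + 1#
    points-bounded p∈ with ∈-++⁻ (map arrival itemList) p∈
    ... | inj₁ p∈a with x , x∈ , refl ← ∈-map⁻ arrival {xs = itemList} p∈a =
      All.lookup {P = λ x → 0# ≤ arrival x × arrival x ≤ ε + 1#}
        (all-items (λ _ → ≤-refl , ≤-trans (<⇒≤ 0<ε) (x≤x+y 0≤1))) {x} x∈
    ... | inj₂ p∈d with x , x∈ , refl ← ∈-map⁻ departure {xs = itemList} p∈d =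
      All.lookup {P = λ x → 0# ≤ departure x × departure x ≤ ε + 1#} (all-items (λ b →
        subst (λ d → 0# ≤ d × d ≤ ε + 1#) (sym (item-departure b)) (<⇒≤ (0<lifetime b) , lifetime≤ε+1 b))) {x} x∈

    length-itemsAt : ∀ t → length (itemsAt t adversary) ℕ.≤ n
    length-itemsAt t = ℕₚ.≤-trans (length-filter (present? t) itemList)
      (ℕₚ.≤-reflexive (length-toList (items adversary)))

    opt≤k : ∀ t → opt t ℕ.≤ k
    opt≤k t = minBins-≤ (itemsAt t adversary) (length-itemsAt t)

    -- A survivor keeps a bin open during the whole interval. Strictness makes the product with a
    -- negative β negative.
    OPT-positive : ∀ {i} → i ∈ S → 0# < OPT
    OPT-positive {i} i∈S = begin-strict
      0#                             <⟨ 0<lifetime true ⟩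
      ε + 1#                         ≡⟨ *-identityʳ _ ⟨
      (ε + 1#) * 1#                  ≡⟨ cong₂ _*_ (x-0≡x (ε + 1#)) (+-identityʳ 1#) ⟨
      (ε + 1# - 0#) * fromℕ 1        ≤⟨ stepIntegral-≥ opt 1 (0∈points i) (∈-++⁺ʳ (map arrival itemList) (ε+1∈departures i∈S))
                                          (<⇒≤ (0<lifetime true)) 1≤opt ⟩
      OPT                            ∎
      where
      open ≤-Reasoning
      1≤opt : ∀ t → 0# ≤ t → t < ε + 1# → 1 ℕ.≤ opt t
      1≤opt t 0≤t t<ε+1 with opt t | opt-isMinBins t
      ... | suc _ | _ = ℕ.s≤s ℕ.z≤n
      -- A packing without open bins is empty, whereas a survivor is present at `t`.
      ... | zero  | (([] , eq , _) , _) with () ← subst (lookup (items adversary) i ∈_) (sym eq)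
        (∈-filter⁺ (present? t) {xs = itemList} (∈-toList⁺ (∈-lookup i (items adversary))) (present-survivor i∈S 0≤t t<ε+1))

    module _ (S≤k : length S ℕ.≤ k) where

      opt≤1 : ∀ t → ε ≤ t → opt t ℕ.≤ 1
      opt≤1 t ε≤t = minBins-≤ (itemsAt t adversary) (begin
        length (filter (present? t) itemList)                     ≡⟨ cong (length ∘ filter (present? t)) itemList≡map ⟩
        length (filter (present? t) (map itemOf (allFin n)))      ≡⟨ length-filter-map (present? t) itemOf (allFin n) ⟩
        length (filter (present? t ∘ itemOf) (allFin n))          ≤⟨ length-unique-⊆ (Uniqueₚ.filter⁺ (present? t ∘ itemOf)
                                                                         (Uniqueₚ.allFin⁺ n)) late ⟩
        length S                                                  ≤⟨ S≤k ⟩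
        k                                                         ≡⟨ ℕₚ.*-identityˡ k ⟨
        1 ℕ.* k                                                   ∎)
        where
        open ℕₚ.≤-Reasoning
        late : ∀ {i} → i ∈ filter (present? t ∘ itemOf) (allFin n) → i ∈ S
        late i∈ = present-late ε≤t (proj₂ (∈-filter⁻ (present? t ∘ itemOf) {xs = allFin n} i∈))

      -- Unless every item survives, ε is one of the points at which OPT is evaluated.
      OPT-≤ : Fin n → OPT ≤ ε * fromℕ k + 1#
      OPT-≤ i₀ with Finₚ.all? (λ i → any? (i Finₚ.≟_) S)
      -- Here `n ≤ k`, so one bin suffices at all times and 0 takes over the role of the dividing
      -- point.
      ... | yes all∈S = begin
        OPT
          ≤⟨ stepIntegral-≤ opt {k} {1} opt≤k (λ t _ → everywhere t) (0∈points i₀) points-bounded ⟩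
        (0# - 0#) * fromℕ k + (ε + 1# - 0#) * fromℕ 1
          ≡⟨ cong₂ (λ x y → x * fromℕ k + y * fromℕ 1) (x-0≡x 0#) (x-0≡x (ε + 1#)) ⟩
        0# * fromℕ k + (ε + 1#) * fromℕ 1
          ≡⟨ cong₂ _+_ (zeroˡ (fromℕ k)) (trans (cong ((ε + 1#) *_) (+-identityʳ 1#)) (*-identityʳ (ε + 1#))) ⟩
        0# + (ε + 1#)
          ≡⟨ +-identityˡ _ ⟩
        ε + 1#
          ≡⟨ cong (_+ 1#) (*-identityʳ ε) ⟨
        ε * 1# + 1#
          ≤⟨ +-monoˡ-≤ 1# (*-monoˡ-≤ (<⇒≤ 0<ε) (x≤x+y (0≤fromℕ k′))) ⟩
        ε * fromℕ k + 1# ∎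
        where
        open ≤-Reasoning
        n≤1k : n ℕ.≤ 1 ℕ.* k
        n≤1k = ℕₚ.≤-trans
                 (subst (ℕ._≤ length S) (length-tabulate id) (length-unique-⊆ (Uniqueₚ.allFin⁺ n) (λ {i} _ → all∈S i)))
                 (ℕₚ.≤-trans S≤k (ℕₚ.≤-reflexive (sym (ℕₚ.*-identityˡ k))))
        everywhere : ∀ t → opt t ℕ.≤ 1
        everywhere t = minBins-≤ (itemsAt t adversary) (ℕₚ.≤-trans (length-itemsAt t) n≤1k)
      ... | no ¬all∈S with i , i∉S ← Finₚ.¬∀⟶∃¬ n _ (λ i → any? (i Finₚ.≟_) S) ¬all∈S = begin
        OPT
          ≤⟨ stepIntegral-≤ opt {k} {1} opt≤k opt≤1 (∈-++⁺ʳ (map arrival itemList) ε∈departures) points-bounded ⟩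
        (ε - 0#) * fromℕ k + (ε + 1# - ε) * fromℕ 1
          ≡⟨ cong₂ (λ x y → x * fromℕ k + y * fromℕ 1) (x-0≡x ε)
                   (trans (cong (_- ε) (+-comm ε 1#)) (+-‿-cancel 1# ε)) ⟩
        ε * fromℕ k + 1# * fromℕ 1
          ≡⟨ cong (ε * fromℕ k +_) (trans (*-identityˡ _) (+-identityʳ 1#)) ⟩
        ε * fromℕ k + 1# ∎
        where
        open ≤-Reasoning
        ε∈departures : ε ∈ map departure itemList
        ε∈departures = subst (_∈ map departure itemList)
          (trans (cong (departure ∘ item) (dec-false (any? (i Finₚ.≟_) S) i∉S)) (item-departure false))
          (∈-map⁺ departure (itemOf∈itemList i))

    -- All departures lie after time 0 since ε is positive, so nothing that distinguishes survivors
    -- is visible yet.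
    history-0 : history 0# adversary ≡ map (const (0# , σ , nothing)) (allFin n)
    history-0 = begin
      map (observe 0#) (filter (λ x → arrival x ≤? 0#) itemList)
        ≡⟨ cong (map (observe 0#)) (filter-all (λ x → arrival x ≤? 0#) (all-items (λ _ → ≤-refl))) ⟩
      map (observe 0#) itemList
        ≡⟨ cong (map (observe 0#)) itemList≡map ⟩
      map (observe 0#) (map itemOf (allFin n))
        ≡⟨ map-∘ (allFin n) ⟨
      map (observe 0# ∘ itemOf) (allFin n)
        ≡⟨ map-cong (λ i → observe-item _) (allFin n) ⟩
      map (const (0# , σ , nothing)) (allFin n) ∎
      where
      open ≡-Reasoning
      observe-item : ∀ b → observe 0# (item b) ≡ (0# , σ , nothing)
      observe-item b rewrite dec-false (departure (item b) ≤? 0#)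
        (<⇒≱ (subst (0# <_) (sym (item-departure b)) (0<lifetime b))) = refl

  -- The cost of a deterministic algorithm for a given set of survivors.

  module _ (A : DeterministicAlgorithm) where

    open DeterministicAlgorithm A

    initialLog : List (Fin n) → Log n
    initialLog S = cut 0# (run (adversary S))

    -- The same history at time 0 yields the same log up to time 0, migrations at that instant
    -- included; `[]` serves as reference draw.
    initialLog-const : ∀ S → initialLog S ≡ initialLog []
    initialLog-const S = injective (trans (sym (upToTime≡ S)) (trans
      (nonClairvoyant (adversary S) (adversary []) 0# (trans (history-0 S) (sym (history-0 [])))) (upToTime≡ [])))
      where
      upToTime≡ : ∀ S → upToTime 0# (run (adversary S)) ≡ (n , initialLog S)
      upToTime≡ S = upToTime-cut (items (adversary S)) (arrival≡0 S) (run (adversary S)) ≤-refl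
        (proj₁ (valid (adversary S)))
      injective : ∀ {l l′ : Log n} → _≡_ {A = ∃ Log} (n , l) (n , l′) → l ≡ l′
      injective refl = refl

    initialBins : Vec ℕ n
    initialBins = bins (initialLog [])

    initialBins-count : ∀ b → count b (map (lookup initialBins) (allFin n)) ℕ.≤ k
    initialBins-count b = subst (λ ys → count b ys ℕ.≤ k)
      (trans (map-proj₂-zip xs initialBins) (sym (map-lookup-allFin initialBins)))
      (feasible⇒count≤k {p} (zipped (λ _ → refl)) (subst Feasible initial (proj₂ (valid (adversary [])) 0#)) b)
      where
      xs = items (adversary [])
      p = toList (Vec.zip xs initialBins)
      zipped : ∀ {P : Item → Set} → (∀ b → P (item b)) → All (P ∘ proj₁) p
      zipped {P} Pitem = Allₚ.map⁻ (subst (All P) (sym (map-proj₁-zip xs initialBins)) (all-items [] Pitem))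
      initial : packingAt 0# xs (run (adversary [])) ≡ p
      initial = trans (packingAt-cut xs (arrival≡0 []) (run (adversary [])) ≤-refl (proj₁ (valid (adversary []))))
        (filter-all (present? 0# ∘ proj₁)
          (zipped (λ b → ≤-refl , subst (0# <_) (sym (item-departure b)) (0<lifetime b))))

    -- All migrations of the run are charged, whenever they happen, which makes the bound
    -- independent of `t` and ready to be integrated.
    openBins-≥ : ∀ S t → 0# ≤ t → t < ε + 1# →
      hits (lookup initialBins) S ℕ.∸ migrations (run (adversary S))
      ℕ.≤ openBins (packingAt t (items (adversary S)) (run (adversary S)))
    openBins-≥ S t 0≤t t<ε+1 = ℕₚ.m≤n+o⇒m∸n≤o _ (migrations l) (begin
      hits (lookup initialBins) S
        ≡⟨ cong (λ l → hits (lookup (bins l)) S) (trans (sym (initialLog-const S)) (sym (cut-cut l 0≤t))) ⟩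
      hits (lookup (bins (cut 0# (cut t l)))) S
        ≤⟨ hits-cut S 0# (cut t l) ⟩
      hits (lookup (bins (cut t l))) S ℕ.+ migrations (cut t l)
        ≤⟨ ℕₚ.+-mono-≤ (hits-≤-openBins S t xs (bins (cut t l)) (λ i∈S → present-survivor S i∈S 0≤t t<ε+1))
                       (migrations-cut t l) ⟩
      openBins (presentIn t xs (bins (cut t l))) ℕ.+ migrations l
        ≡⟨ cong (λ p → openBins p ℕ.+ migrations l)
                (packingAt-cut xs (arrival≡0 S) l 0≤t (proj₁ (valid (adversary S)))) ⟨
      openBins (packingAt t xs l) ℕ.+ migrations l
        ≡⟨ ℕₚ.+-comm _ (migrations l) ⟩
      migrations l ℕ.+ openBins (packingAt t xs l)
        ∎)
      where
      open ℕₚ.≤-Reasoning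
      l = run (adversary S)
      xs = items (adversary S)

    -- The bins stay open for longer than unit time, which gives the strict inequality that
    -- `exceeds` asks for. The survivor `i` makes `ε + 1#` a point of the integral.
    activeTime-> : ∀ S {i} → i ∈ S → ∀ j → j ℕ.< hits (lookup initialBins) S ℕ.∸ migrations (run (adversary S)) →
                   fromℕ (suc j) < activeTime (adversary S) (run (adversary S))
    activeTime-> S {i} i∈S j j<h = begin-strict
      fromℕ (suc j)                    ≤⟨ fromℕ-mono-≤ j<h ⟩
      fromℕ h                          ≡⟨ *-identityʳ (fromℕ h) ⟨
      fromℕ h * 1#                     <⟨ *-monoˡ-< (<-≤-trans (0<fromℕ-suc j) (fromℕ-mono-≤ j<h)) 1<ε+1 ⟩
      fromℕ h * (ε + 1#)               ≡⟨ *-comm (fromℕ h) (ε + 1#) ⟩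
      (ε + 1#) * fromℕ h               ≡⟨ cong (_* fromℕ h) (x-0≡x (ε + 1#)) ⟨
      (ε + 1# - 0#) * fromℕ h          ≤⟨ stepIntegral-≥ (λ t → openBins (packingAt t (items (adversary S)) l)) h
        (∈-++⁺ˡ (0∈times (items (adversary S)) (arrival≡0 S) l i (proj₁ (valid (adversary S)))))
        (∈-++⁺ʳ (times l) (ε+1∈departures S i∈S)) (<⇒≤ (0<lifetime true)) (openBins-≥ S) ⟩
      activeTime (adversary S) l       ∎
      where
      open ≤-Reasoning
      l = run (adversary S)
      h = hits (lookup initialBins) S ℕ.∸ migrations l
      1<ε+1 : 1# < ε + 1#
      1<ε+1 = subst (1# <_) (+-comm 1# ε) (x<x+y 0<ε)

  -- Averaging over the draws for a randomized algorithm.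

  module _ (A : RandomizedAlgorithm) where

    open RandomizedAlgorithm A
    open ProbabilityProperties reals
    open SimpleFunction

    game : Vec (Fin n) k → Instance n
    game w = adversary (toList w)

    -- The cost need not be an integer, so its levels start at 1: exceeding j does not give j + 1.
    -- The number of migrations is an integer, and exceeding j does. With `n` levels there are
    -- enough, as at most `k` bins are hit.
    costLevels migrationLevels : Vec (Fin n) k → SimpleFunction
    costLevels w = staircase space (cost (game w)) (cost-isRandomVariable (game w)) (fromℕ ∘ suc) n
    migrationLevels w =
      staircase space (migrationCount (game w)) (migrationCount-isRandomVariable (game w)) fromℕ n

    cost-nonNegative : ∀ {m} (I : Instance m) ω → 0# ≤ cost I ω
    cost-nonNegative I ω = stepIntegral-nonNegative _ (times (runOn I ω) ++ map departure (toList (items I)))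

    costLevels-≤ : ∀ w ω → value (costLevels w) ω ≤ cost (game w) ω
    costLevels-≤ w = staircase-≤ space (cost (game w)) (cost-isRandomVariable (game w)) (fromℕ ∘ suc)
      (cost-nonNegative (game w)) (λ _ _ → <⇒≤) n

    migrationLevels-≤ : ∀ w ω → value (migrationLevels w) ω ≤ migrationCount (game w) ω
    migrationLevels-≤ w =
      staircase-≤ space (migrationCount (game w)) (migrationCount-isRandomVariable (game w)) fromℕ
        (λ ω → 0≤fromℕ (migrations (runOn (game w) ω)))
        (λ ω j j<m → fromℕ-mono-≤ (fromℕ-cancel-< {j} {migrations (runOn (game w) ω)} j<m)) n

    levels : Vec (Fin n) k → SimpleFunction
    levels w = _+ˢ_ space (costLevels w) (migrationLevels w)

    -- With h bins hit and m migrations, the cost reaches `h ∸ m` levels and the migrations `m ⊓ h`;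
    -- truncation makes the two add up to h even when m exceeds h.
    hits-≤-levels : ∀ w ω → fromℕ (hits (lookup (initialBins (algorithm ω))) (toList w)) ≤ value (levels w) ω
    hits-≤-levels w@(_ ∷ _) ω = begin
      fromℕ h                                                         ≡⟨ cong fromℕ (ℕₚ.m⊓n+n∸m≡n m h) ⟨
      fromℕ (m ℕ.⊓ h ℕ.+ (h ℕ.∸ m))                                   ≡⟨ fromℕ-+ (m ℕ.⊓ h) (h ℕ.∸ m) ⟩
      fromℕ (m ℕ.⊓ h) + fromℕ (h ℕ.∸ m)                               ≡⟨ +-comm _ _ ⟩
      fromℕ (h ℕ.∸ m) + fromℕ (m ℕ.⊓ h)                               ≤⟨ +-mono-≤
        (staircase-≥ space (cost (game w)) (cost-isRandomVariable (game w)) (fromℕ ∘ suc) ω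
          (ℕₚ.≤-trans (ℕₚ.m∸n≤m h m) h≤n) (activeTime-> (algorithm ω) (toList w) (here refl)))
        (staircase-≥ space (migrationCount (game w)) (migrationCount-isRandomVariable (game w)) fromℕ ω
          (ℕₚ.≤-trans (ℕₚ.m⊓n≤n m h) h≤n) (λ j j<m⊓h → fromℕ-mono-< (ℕₚ.≤-trans j<m⊓h (ℕₚ.m⊓n≤m m h)))) ⟩
      value (costLevels w) ω + value (migrationLevels w) ω            ≡⟨ value-+ˢ space (costLevels w) (migrationLevels w) ω ⟨
      value (levels w) ω                                              ∎
      where
      open ≤-Reasoning
      bs = initialBins (algorithm ω)
      h = hits (lookup bs) (toList w)
      m = migrations (runOn (game w) ω)
      h≤n : h ℕ.≤ n
      h≤n = ℕₚ.≤-trans (card-≤ {map (lookup bs) (toList w)} id)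
        (ℕₚ.≤-trans (ℕₚ.≤-reflexive (trans (length-map (lookup bs) (toList w)) (length-toList w))) (ℕₚ.m≤m*n k k))

    -- Half of the expected number of bins hit, the other half being the budget for migrations.
    q : ℝ
    q = fromℕ 4 ⁻¹ * fromℕ k

    4q≡k : (q + q) + (q + q) ≡ fromℕ k
    4q≡k = begin-equality
      (q + q) + (q + q)       ≡⟨ cong₂ _+_ (2x q) (2x q) ⟨
      fromℕ 2 * q + fromℕ 2 * q  ≡⟨ distribʳ q (fromℕ 2) (fromℕ 2) ⟨
      (fromℕ 2 + fromℕ 2) * q ≡⟨ cong (_* q) (fromℕ-+ 2 2) ⟨
      fromℕ 4 * q             ≡⟨ *-assoc (fromℕ 4) (fromℕ 4 ⁻¹) (fromℕ k) ⟨
      fromℕ 4 * fromℕ 4 ⁻¹ * fromℕ k  ≡⟨ cong (_* fromℕ k) (⁻¹-inverse (fromℕ 4) (>⇒≢0 (0<fromℕ-suc 3))) ⟩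
      1# * fromℕ k            ≡⟨ *-identityˡ (fromℕ k) ⟩
      fromℕ k                 ∎
      where
      open ≤-Reasoning
      2x : ∀ x → fromℕ 2 * x ≡ x + x
      2x x = trans (distribʳ x 1# (fromℕ 1)) (cong₂ _+_ (*-identityˡ x)
        (trans (cong (_* x) (+-identityʳ 1#)) (*-identityˡ x)))

    ws : List (Vec (Fin n) k)
    ws = words (allFin n) k

    -- At each outcome `average-hits` is applied to the initial bins of that outcome; the resulting
    -- bound is the same constant everywhere, so `integral-≥` applies.
    levels-integral-≥ : fromℕ (length ws) * (q + q) ≤ sumℝ (map (integral ∘ levels) ws)
    levels-integral-≥ = begin
      fromℕ (length ws) * (q + q)            ≤⟨ integral-≥ space _ (sumˢ space (map levels ws)) pointwise ⟩
      integral (sumˢ space (map levels ws))  ≡⟨ integral-sumˢ space (map levels ws) ⟩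
      sumℝ (map integral (map levels ws))    ≡⟨ cong sumℝ (map-∘ ws) ⟨
      sumℝ (map (integral ∘ levels) ws)      ∎
      where
      open ≤-Reasoning
      pointwise : ∀ ω → fromℕ (length ws) * (q + q) ≤ value (sumˢ space (map levels ws)) ω
      pointwise ω = begin
        fromℕ (length ws) * (q + q)                 ≤⟨ halve ⟩
        fromℕ (totalHits (allFin n) (lookup bs) k)   ≤⟨ fromℕ-sumBy ws (λ w → hits-≤-levels w ω) ⟩
        sumℝ (map (λ w → value (levels w) ω) ws)    ≡⟨ cong sumℝ (map-∘ ws) ⟩
        sumℝ (map (λ φ → value φ ω) (map levels ws)) ≡⟨ value-sumˢ space (map levels ws) ω ⟨
        value (sumˢ space (map levels ws)) ω        ∎
        where
        bs = initialBins (algorithm ω)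
        total = totalHits (allFin n) (lookup bs) k
        average : k ℕ.* length ws ℕ.≤ 2 ℕ.* total
        average = average-hits (allFin n) (lookup bs) k (initialBins-count (algorithm ω)) (length-tabulate id)
        halve : fromℕ (length ws) * (q + q) ≤ fromℕ total
        halve = *-cancelˡ-≤ (0<fromℕ-suc 1) (begin
          fromℕ 2 * (fromℕ (length ws) * (q + q))
            ≡⟨ cong (_* (fromℕ (length ws) * (q + q))) (cong (1# +_) (+-identityʳ 1#)) ⟩
          (1# + 1#) * (fromℕ (length ws) * (q + q))
            ≡⟨ solve 2 (λ l q → (con 1 :+ con 1) :* (l :* (q :+ q)) := ((q :+ q) :+ (q :+ q)) :* l)
                 refl (fromℕ (length ws)) q ⟩
          ((q + q) + (q + q)) * fromℕ (length ws)
            ≡⟨ cong (_* fromℕ (length ws)) 4q≡k ⟩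
          fromℕ k * fromℕ (length ws)
            ≡⟨ fromℕ-* k (length ws) ⟨
          fromℕ (k ℕ.* length ws)
            ≤⟨ fromℕ-mono-≤ average ⟩
          fromℕ (2 ℕ.* total)
            ≡⟨ fromℕ-* 2 total ⟩
          fromℕ 2 * fromℕ total ∎)
          where open Solver using (solve; _:=_; _:+_; _:*_; con)

    -- For a word that is at least average, `migrationLevels` lies below `migrationCount`, so the
    -- hypothesis on migrations takes away at most `q` of the `q + q`.
    costly-word : ∀ {α} → MigratesAtMost α A → α * fromℕ n ≤ q → ∃ λ w → q ≤ integral (costLevels w)
    costly-word mig αn≤q = map₂ (λ {w} → cancel w)
      (average-≤ (q + q) (integral ∘ levels) ws (words-nonempty (∈-allFin {n} Fin.zero) k) levels-integral-≥)
      where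
      open ≤-Reasoning
      cancel : ∀ w → q + q ≤ integral (levels w) → q ≤ integral (costLevels w)
      cancel w 2q≤ = +-cancelʳ-≤ q (begin
        q + q
          ≤⟨ 2q≤ ⟩
        integral (levels w)
          ≡⟨ integral-+ˢ space (costLevels w) (migrationLevels w) ⟩
        integral (costLevels w) + integral (migrationLevels w)
          ≤⟨ +-monoʳ-≤ _ (≤-trans (mig (game w) (migrationLevels w) (migrationLevels-≤ w)) αn≤q) ⟩
        integral (costLevels w) + q ∎)

-- Choice of k and ε, and the case of a floor that is not positive.

theorem3 : (reals : RealNumbers) →
    let open RealNumbers reals
        open BinPacking reals
    in
    (α : ℝ) → 0# < α → α < 1# →
    (A : RandomizedAlgorithm) → MigratesAtMost α A →
    CompetitiveRatioAtLeast (fromℕ 4 ⁻¹ * fromℤ ⌊ (fromℕ 4 * α) ⁻¹ ⌋) A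
theorem3 reals α 0<α _ A mig β β<γ = bound ⌊ (fromℕ 4 * α) ⁻¹ ⌋ (floor-lower _) β<γ
  where
  open RealNumbers reals
  open OrderedFieldProperties orderedField
  open BinPacking reals
  open RandomizedAlgorithm A
  open ≤-Reasoning

  0<4⁻¹ : 0# < fromℕ 4 ⁻¹
  0<4⁻¹ = ⁻¹-positive (0<fromℕ-suc 3)

  0<4α : 0# < fromℕ 4 * α
  0<4α = *-positive (0<fromℕ-suc 3) 0<α

  Conclusion : Set
  Conclusion = ∃₂ λ n (I : Instance n) → ∃ λ opt → IsOPT I opt × 𝔼[ cost I ]> (β * opt)

  -- For negative β the zero function is already a witness, on a single surviving item: k = 1 and ε
  -- = 1.
  nonPositive : β < 0# → Conclusion
  nonPositive β<0 = n , adversary S , OPT S , OPT-isOPT S , 0ˢ space , cost-nonNegative A (adversary S) ,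
    subst₂ _<_ (*-comm (OPT S) β) (zeroʳ (OPT S)) (*-monoˡ-< (OPT-positive S (here refl)) β<0)
    where
    open Adversary reals 0 1# 0<1
    open ProbabilityProperties reals
    S = Fin.zero ∷ []

  positive : ∀ k′ → fromℕ (suc k′) ≤ (fromℕ 4 * α) ⁻¹ → β < fromℕ 4 ⁻¹ * fromℕ (suc k′) → Conclusion
  positive k′ k≤ β<q = conclude (costly-word A mig αn≤q)
    where
    K Q D ε : ℝ
    K = fromℕ (suc k′)
    Q = fromℕ 4 ⁻¹ * K
    D = K * Q + 1#
    0<Q : 0# < Q
    0<Q = *-positive 0<4⁻¹ (0<fromℕ-suc k′)
    0<D : 0# < D
    0<D = <-≤-trans (*-positive (0<fromℕ-suc k′) 0<Q) (x≤x+y 0≤1)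
    -- β (εK + 1) < Q because βK < D and D * ε = Q − β.
    ε = D ⁻¹ * (Q - β)
    0<ε : 0# < ε
    0<ε = *-positive (⁻¹-positive 0<D) (x<y⇒0<y-x β<q)

    open Adversary reals k′ ε 0<ε
    open ProbabilityProperties reals

    -- The floor gives 4αk ≤ 1; multiplied by k this bounds the budget αk² by k/4.
    αn≤q : α * fromℕ n ≤ Q
    αn≤q = *-cancelˡ-≤ (0<fromℕ-suc 3) (begin
      fromℕ 4 * (α * fromℕ n)                   ≡⟨ cong (λ x → fromℕ 4 * (α * x)) (fromℕ-* (suc k′) (suc k′)) ⟩
      fromℕ 4 * (α * (K * K))                   ≡⟨ solve 3 (λ f α K → f :* (α :* (K :* K)) := f :* α :* K :* K)
                                                      refl (fromℕ 4) α K ⟩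
      fromℕ 4 * α * K * K                       ≤⟨ *-monoʳ-≤ (0≤fromℕ (suc k′)) (*-monoˡ-≤ (<⇒≤ 0<4α) k≤) ⟩
      fromℕ 4 * α * (fromℕ 4 * α) ⁻¹ * K        ≡⟨ cong (_* K) (⁻¹-inverse (fromℕ 4 * α) (>⇒≢0 0<4α)) ⟩
      1# * K                                    ≡⟨ cong (_* K) (⁻¹-inverse (fromℕ 4) (>⇒≢0 (0<fromℕ-suc 3))) ⟨
      fromℕ 4 * fromℕ 4 ⁻¹ * K                  ≡⟨ *-assoc (fromℕ 4) (fromℕ 4 ⁻¹) K ⟩
      fromℕ 4 * Q                               ∎)
      where open Solver using (solve; _:=_; _:*_)

    β*-< : ∀ {v} → 0# ≤ v → v ≤ ε * K + 1# → β * v < Q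
    β*-< {v} 0≤v v≤ with ≤-<-connex β 0#
    ... | inj₁ β≤0 = ≤-<-trans (subst (β * v ≤_) (zeroˡ v) (*-monoʳ-≤ 0≤v β≤0)) 0<Q
    ... | inj₂ 0<β = begin-strict
      β * v                     ≤⟨ *-monoˡ-≤ (<⇒≤ 0<β) v≤ ⟩
      β * (ε * K + 1#)          ≡⟨ solve 3 (λ β ε K → β :* (ε :* K :+ con 1) := β :* (ε :* K) :+ β) refl β ε K ⟩
      β * (ε * K) + β           ≤⟨ +-monoˡ-≤ β (*-monoʳ-≤ (*-nonNegative (<⇒≤ 0<ε) (0≤fromℕ (suc k′))) (<⇒≤ β<q)) ⟩
      -- The summand ε, which stems from the `1#` in `D`, makes the estimate strict.
      Q * (ε * K) + β           <⟨ +-monoˡ-< β (x<x+y 0<ε) ⟩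
      Q * (ε * K) + ε + β       ≡⟨ cong (_+ β) (solve 3 (λ Q ε K → Q :* (ε :* K) :+ ε := (K :* Q :+ con 1) :* ε)
                                     refl Q ε K) ⟩
      D * ε + β                 ≡⟨ cong (_+ β) (*-⁻¹-cancel 0<D (Q - β)) ⟩
      Q - β + β                 ≡⟨ -‿+-cancel Q β ⟩
      Q                         ∎
      where open Solver using (solve; _:=_; _:+_; _:*_; con)

    conclude : (∃ λ w → Q ≤ SimpleFunction.integral (costLevels A w)) → Conclusion
    conclude (w@(i ∷ _) , Q≤) =
      n , adversary S , OPT S , OPT-isOPT S , costLevels A w , costLevels-≤ A w ,
      <-≤-trans (β*-< (<⇒≤ (OPT-positive S (here refl))) (OPT-≤ S (ℕₚ.≤-reflexive (length-toList w)) i)) Q≤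
      where S = toList w

  bound : ∀ z → fromℤ z ≤ (fromℕ 4 * α) ⁻¹ → β < fromℕ 4 ⁻¹ * fromℤ z → Conclusion
  bound (ℤ.+ suc k′)  k≤ β<q = positive k′ k≤ β<q
  bound (ℤ.+ zero)    _  β<q = nonPositive (subst (β <_) (zeroʳ _) β<q)
  bound ℤ.-[1+ k′ ]   _  β<q = nonPositive (<-≤-trans β<q
    (subst (fromℕ 4 ⁻¹ * (- fromℕ (suc k′)) ≤_) (zeroʳ _) (*-monoˡ-≤ (<⇒≤ 0<4⁻¹)
      (subst (- fromℕ (suc k′) ≤_) -0≡0 (-‿antitone (0≤fromℕ (suc k′)))))))
    where
    -0≡0 : - 0# ≡ 0#
    -0≡0 = trans (sym (+-identityˡ (- 0#))) (-‿inverseʳ 0#)
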